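{- Let $k$ be a positive integer. For every affine permutation $w\in\widetilde{S}_{k+1}$, the affine Stanley symmetric polynomial $\widetilde{F}_w$ (in finitely many variables $x_1,\ldots,x_n$) is M-convex.
   Context: $\widetilde{S}_{k+1}$ is the affine symmetric group generated by $s_0,\ldots,s_k$ with relations $s_i^2=\mathrm{id}$, $s_is_{i+1}s_i=s_{i+1}s_is_{i+1}$, and $s_is_j=s_js_i$ when $|i-j|\ne1\bmod(k+1)$ (indices mod $k+1$). The length $\ell(w)$ is the length of a reduced (shortest) word for $w$. An element $w$ is cyclically decreasing if it has a reduced word $s_{i_1}\cdots s_{i_l}$ in which all generators are distinct and, whenever both $s_i$ and $s_{i+1}$ occur, $s_{i+1}$ precedes $s_i$. A cyclically decreasing decomposition of $w$ is a factorization $w=w^1w^2\cdots w^r$ with each $w^i$ cyclically decreasing and $\ell(w)=\sum_i\ell(w^i)$. The affine Stanley symmetric function is $\widetilde{F}_w=\sum x_1^{\ell(w^1)}x_2^{\ell(w^2)}\cdots x_r^{\ell(w^r)}$ over all cyclically decreasing decompositions of $w$; the polynomial is obtained by setting $x_i=0$ for $i>n$. A polynomial is M-convex if its support $J=\{\alpha\in\mathbb{N}^n:\text{coefficient of }x^\alpha\ne0\}$ satisfies: for all $\alpha,\beta\in J$ and every $i$ with $\alpha_i>\beta_i$ there is $j$ with $\alpha_j<\beta_j$ and $\alpha-e_i+e_j\in J$. -}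

module Defs where

open import Data.Nat using (ℕ; zero; suc; _+_; _∸_; _≤_; _<_)
open import Data.Fin using (Fin; fromℕ; inject₁) renaming (zero to fzero; suc to fsuc)
open import Data.Fin.Properties using () renaming (_≟_ to _≟ᶠ_)
open import Data.List using (List; []; _∷_; _++_; length)
open import Data.List.Membership.Propositional using (_∈_)
open import Data.List.Relation.Unary.Unique.Propositional using (Unique)
open import Data.Product using (Σ; ∃; ∃-syntax; _×_; _,_)
open import Relation.Binary.PropositionalEquality using (_≡_; _≢_)
open import Relation.Nullary using (yes; no)

-- The affine symmetric group S̃_{k+1}, via its Coxeter presentation.
-- Generators s_0,…,s_k are indexed by Fin (suc k); an element is
-- represented by a word (list of generators), and two words represent
-- the same element iff they are related by the congruence generated by
-- the defining relations.

Gen : ℕ → Set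
Gen k = Fin (suc k)

Word : ℕ → Set
Word k = List (Gen k)

sucMod : ∀ {k} → Gen k → Gen k
sucMod {zero}  fzero    = fzero
sucMod {suc k} fzero    = fsuc fzero
sucMod {suc k} (fsuc i) with sucMod {k} i
... | fzero  = fzero
... | fsuc j = fsuc (fsuc j)

data BasicRel (k : ℕ) : Word k → Word k → Set where
  square  : (i : Gen k) → BasicRel k (i ∷ i ∷ []) []
  -- s_i s_{i+1} s_i = s_{i+1} s_i s_{i+1}  (only when k+1 ≥ 3: for k+1 = 2
  -- the affine symmetric group is the infinite dihedral group)
  braid   : 2 ≤ k → (i : Gen k) →
            BasicRel k (i ∷ sucMod i ∷ i ∷ []) (sucMod i ∷ i ∷ sucMod i ∷ [])
  commute : (i j : Gen k) → j ≢ sucMod i → i ≢ sucMod j →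
            BasicRel k (i ∷ j ∷ []) (j ∷ i ∷ [])

data _≈_ {k : ℕ} : Word k → Word k → Set where
  ≈-refl  : ∀ {u} → u ≈ u
  ≈-sym   : ∀ {u v} → u ≈ v → v ≈ u
  ≈-trans : ∀ {u v w} → u ≈ v → v ≈ w → u ≈ w
  ≈-rel   : ∀ a {l r} b → BasicRel k l r → (a ++ l ++ b) ≈ (a ++ r ++ b)

IsLength : ∀ {k} → Word k → ℕ → Set
IsLength {k} w m =
  (Σ (Word k) λ u → (u ≈ w) × (length u ≡ m)) ×
  (∀ (u : Word k) → u ≈ w → m ≤ length u)

Reduced : ∀ {k} → Word k → Set
Reduced u = IsLength u (length u)

Precedes : ∀ {k} → Gen k → Gen k → Word k → Set
Precedes {k} x y u =
  ∃[ a ] ∃[ b ] ∃[ c ] (u ≡ a ++ (x ∷ b) ++ (y ∷ c))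

CyclicallyDecreasing : ∀ {k} → Word k → Set
CyclicallyDecreasing {k} w =
  Σ (Word k) λ u → (u ≈ w) × Reduced u × Unique u ×
    (∀ (i : Gen k) → i ∈ u → sucMod i ∈ u → Precedes (sucMod i) i u)

sumF : ∀ {n} → (Fin n → ℕ) → ℕ
sumF {zero}  f = 0
sumF {suc n} f = f fzero + sumF (λ i → f (fsuc i))

prodF : ∀ {k n} → (Fin n → Word k) → Word k
prodF {n = zero}  f = []
prodF {n = suc n} f = f fzero ++ prodF (λ i → f (fsuc i))

-- Support of the affine Stanley symmetric polynomial F̃_w(x_1,…,x_n).
-- All coefficients are nonnegative counts, so x^α has nonzero coefficient
-- iff there is a cyclically decreasing decomposition w = w^1 ⋯ w^n
-- (factors beyond n must be the identity after setting x_i = 0, i > n)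
-- with ℓ(w^i) = α_i.

InSupport : ∀ {k} → Word k → (n : ℕ) → (Fin n → ℕ) → Set
InSupport {k} w n α =
  Σ (Fin n → Word k) λ f →
    (∀ i → CyclicallyDecreasing (f i)) ×
    (∀ i → IsLength (f i) (α i)) ×
    (prodF f ≈ w) ×
    IsLength w (sumF α)

exchange : ∀ {n} → (Fin n → ℕ) → Fin n → Fin n → (Fin n → ℕ)
exchange α i j m =
  (case-i (m ≟ᶠ i)) + (case-j (m ≟ᶠ j))
  where
    case-i : _ → ℕ
    case-i (yes _) = α m ∸ 1
    case-i (no _)  = α m
    case-j : _ → ℕ
    case-j (yes _) = 1
    case-j (no _)  = 0

MConvexSet : (n : ℕ) → ((Fin n → ℕ) → Set) → Set
MConvexSet n J =
  ∀ (α β : Fin n → ℕ) → J α → J β →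
  ∀ (i : Fin n) → β i < α i →
  ∃[ j ] ((α j < β j) × J (exchange α i j))

StanleyPolyMConvex : ∀ {k} → Word k → ℕ → Set
StanleyPolyMConvex w n = MConvexSet n (InSupport w n)

{-# OPTIONS --safe #-}
-- The affine symmetric group acts on vectors c ∈ ℕ^{ℤ/(k+1)}: sᵢ replaces the adjacent entries (a , b)
-- at (i , i+1) by (b + 1 , a) if a ≤ b and by (b , a − 1) otherwise.  The orbit of 0 is free (w ↦ its
-- code), and ℓ(w) is the sum of the code of w.  Up to permuting the entries, multiplying length-additively
-- by a cyclically decreasing element of length l raises l different entries by one.  So a decomposition
-- of w of type α is recorded by a 0/1 matrix with row sums code(w) and column sums α.  Conversely, every
-- α which is the vector of column sums of such a matrix is realised: as in the Gale–Ryser theorem, the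
-- first column may be assumed to hit the largest entries, ties being broken along the circle cut at a
-- zero entry, and then these entries can be lowered by a cyclically decreasing element.  Finally, column
-- sums of 0/1 matrices with given row sums satisfy the exchange property, by an alternating walk.
module Submission where

open import Defs
open import Data.Nat using (ℕ; zero; suc; pred; _+_; _∸_; _≤_; _<_; z≤n; s≤s; _≤?_; _<?_)
open import Data.Nat.Properties
open import Data.Nat.DivMod using (_%_; %-distribˡ-+; m%n%n≡m%n; m≤n⇒m%n≡m; m<n⇒m%n≡m; n%n≡0; [m+n]%n≡m%n; m%n<n)
open import Data.Nat.Induction using (<-wellFounded)
open import Data.Nat.Tactic.RingSolver using (solve-∀)
open import Algebra.Properties.CommutativeSemigroup +-commutativeSemigroup
  using (interchange; x∙yz≈y∙xz; x∙yz≈z∙yx; x∙yz≈xz∙y; xy∙z≈xz∙y; xy∙z≈zy∙x)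
open import Induction.WellFounded using (Acc; acc)
open import Data.Bool using (Bool; true; false; if_then_else_)
import Data.Bool.Properties as Bool
open import Data.Bool.Properties using (¬-not)
open import Data.Fin using (Fin; toℕ) renaming (zero to fzero; suc to fsuc)
open import Data.Fin.Properties using (any?; toℕ<n; toℕ-injective; toℕ≤pred[n]) renaming (_≟_ to _≟ᶠ_)
open import Data.List using ([]; _∷_; _++_; length)
open import Data.List.Properties using (++-assoc; length-++; ∷-injective)
open import Data.List.Membership.Propositional using (_∈_)
open import Data.List.Membership.Propositional.Properties using (∈-∃++; ∈-++⁺ʳ)
open import Data.List.Relation.Unary.All as All using ([]; _∷_)
open import Data.List.Relation.Unary.AllPairs as AllPairs using (AllPairs; []; _∷_)
open import Data.List.Relation.Unary.Any using (here; there)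
open import Data.List.Relation.Unary.Unique.Propositional using (Unique)
open import Data.Product using (∃-syntax; _×_; _,_; proj₁; proj₂; map₂)
open import Data.Sum using (_⊎_; inj₁; inj₂)
open import Data.Vec.Functional as Vector using (updateAt)
open import Data.Vec.Functional.Properties using (updateAt-updates; updateAt-minimal; map-updateAt)
open import Function using (_∘_; const)
open import Relation.Binary.PropositionalEquality
open import Relation.Nullary using (¬_; yes; no; does; contradiction)
open import Relation.Nullary.Decidable using (_×-dec_; dec-true; dec-false)

-- Finite sums and functions updated at one index.

private variable
  n r : ℕ
  X Y : Set

put : (Fin n → X) → Fin n → X → Fin n → X
put f i a = updateAt f i (const a)

put-here : (f : Fin n → X) (i : Fin n) {a : X} → put f i a i ≡ a
put-here f i = updateAt-updates i f

put-else : (f : Fin n → X) {i j : Fin n} {a : X} → j ≢ i → put f i a j ≡ f j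
put-else f {i} {j} = updateAt-minimal j i f

map-put : (g : X → Y) (f : Fin n → X) (i : Fin n) {a : X} →
          g ∘ put f i a ≗ put (g ∘ f) i (g a)
map-put g f i {a} = map-updateAt {f = g} {g = const a} {h = const (g a)} (λ _ → refl) f i

sumF-cong : {f g : Fin n → ℕ} → f ≗ g → sumF f ≡ sumF g
sumF-cong {zero}  f≗g = refl
sumF-cong {suc n} f≗g = cong₂ _+_ (f≗g fzero) (sumF-cong (f≗g ∘ fsuc))

sumF-mono-≤ : {f g : Fin n → ℕ} → (∀ i → f i ≤ g i) → sumF f ≤ sumF g
sumF-mono-≤ {zero}  f≤g = z≤n
sumF-mono-≤ {suc n} f≤g = +-mono-≤ (f≤g fzero) (sumF-mono-≤ (f≤g ∘ fsuc))

sumF-mono-< : {f g : Fin n → ℕ} → (∀ i → f i ≤ g i) → ∀ i → f i < g i → sumF f < sumF g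
sumF-mono-< f≤g fzero    fi<gi = +-mono-<-≤ fi<gi (sumF-mono-≤ (f≤g ∘ fsuc))
sumF-mono-< f≤g (fsuc i) fi<gi = +-mono-≤-< (f≤g fzero) (sumF-mono-< (f≤g ∘ fsuc) i fi<gi)

sumF-zero : (n : ℕ) → sumF {n} (const 0) ≡ 0
sumF-zero zero    = refl
sumF-zero (suc n) = sumF-zero n

sumF-+ : (f g : Fin n → ℕ) → sumF (λ i → f i + g i) ≡ sumF f + sumF g
sumF-+ {zero}  f g = refl
sumF-+ {suc n} f g = trans (cong (f fzero + g fzero +_) (sumF-+ (f ∘ fsuc) (g ∘ fsuc)))
                           (interchange (f fzero) (g fzero) _ _)

sumF-comm : (f : Fin n → Fin r → ℕ) →
            sumF (λ i → sumF (f i)) ≡ sumF (λ j → sumF (λ i → f i j))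
sumF-comm {zero}  {r} f = sym (sumF-zero r)
sumF-comm {suc n} {r} f = trans (cong (sumF (f fzero) +_) (sumF-comm (f ∘ fsuc)))
                                (sym (sumF-+ (f fzero) _))

sumF-put : (f : Fin n → ℕ) (i : Fin n) (a : ℕ) → sumF (put f i a) + f i ≡ sumF f + a
sumF-put f fzero    a = xy∙z≈zy∙x a _ (f fzero)
sumF-put f (fsuc i) a = trans (+-assoc (f fzero) _ _)
  (trans (cong (f fzero +_) (sumF-put (f ∘ fsuc) i a)) (sym (+-assoc (f fzero) _ a)))

-- Two applications of `sumF-put`; since `i ≢ j`, the first update leaves the entry at `i` alone.
-- Replaced entries are added on the left instead of subtracted on the right, which avoids
-- truncation.
sumF-put₂ : (f : Fin n → ℕ) {i j : Fin n} → i ≢ j → (a b : ℕ) →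
            sumF (put (put f j b) i a) + (f i + f j) ≡ sumF f + (a + b)
sumF-put₂ f {i} {j} i≢j a b = +-cancelʳ-≡ (sumF g) _ _ (begin
  sumF (put g i a) + (f i + f j) + sumF g      ≡⟨ shuffle (sumF (put g i a)) (f i) _ _ ⟩
  (sumF (put g i a) + f i) + (sumF g + f j)    ≡⟨ cong₂ _+_ at-i (sumF-put f j b) ⟩
  (sumF g + a) + (sumF f + b)                  ≡⟨ shuffle′ (sumF g) a _ b ⟩
  sumF f + (a + b) + sumF g                    ∎)
  where
  open ≡-Reasoning
  g = put f j b
  at-i : sumF (put g i a) + f i ≡ sumF g + a
  at-i = trans (cong (sumF (put g i a) +_) (sym (put-else f i≢j))) (sumF-put g i a)
  shuffle : ∀ p q r s → p + (q + r) + s ≡ p + q + (s + r)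
  shuffle = solve-∀
  shuffle′ : ∀ p q r s → p + q + (r + s) ≡ r + (q + s) + p
  shuffle′ = solve-∀

≰⇒∃> : (f g : Fin n → ℕ) → ¬ (∀ i → f i ≤ g i) → ∃[ i ] g i < f i
≰⇒∃> f g f≰g with any? (λ i → g i <? f i)
... | yes found = found
... | no none   = contradiction (λ i → ≮⇒≥ (λ gi<fi → none (i , gi<fi))) f≰g

sumF-<⇒∃< : (f g : Fin n → ℕ) → sumF g < sumF f → ∃[ i ] g i < f i
sumF-<⇒∃< f g lt = ≰⇒∃> f g (λ f≤g → <⇒≱ lt (sumF-mono-≤ f≤g))

-- A deficit of `f` at `i` has to be made up elsewhere if the total of `f` is no smaller.
sumF-≤∧>⇒∃< : (f g : Fin n → ℕ) (i : Fin n) → sumF g ≤ sumF f → f i < g i → ∃[ j ] g j < f j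
sumF-≤∧>⇒∃< f g i le lt = ≰⇒∃> f g (λ f≤g → <⇒≱ (sumF-mono-< f≤g i lt) le)

-- 0/1 vectors and matrices, and moving a 1 within a row.

χ : Bool → ℕ
χ b = if b then 1 else 0

χ-<⇒ : ∀ {a b} → χ a < χ b → a ≡ false × b ≡ true
χ-<⇒ {false} {true}  _ = refl , refl
χ-<⇒ {true}  {true}  (s≤s ())
χ-<⇒ {_}     {false} ()

δ : Fin n → Fin n → ℕ
δ i j = χ (does (j ≟ᶠ i))

δ-here : (i : Fin n) → δ i i ≡ 1
δ-here i = cong χ (dec-true (i ≟ᶠ i) refl)

δ-else : {i j : Fin n} → j ≢ i → δ i j ≡ 0
δ-else {i = i} {j} j≢i = cong χ (dec-false (j ≟ᶠ i) j≢i)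

sumF-δ : (i : Fin n) → sumF (δ i) ≡ 1
sumF-δ {suc n} fzero = cong suc (sumF-zero n)
sumF-δ (fsuc i)      = sumF-δ i

Matrix : ℕ → ℕ → Set
Matrix n r = Fin n → Fin r → Bool

size : (Fin r → Bool) → ℕ
size v = sumF (χ ∘ v)

row : Matrix n r → Fin n → ℕ
row A x = size (A x)

col : Matrix n r → Fin r → ℕ
col A t = size (λ x → A x t)

Realizes : Matrix n r → (Fin n → ℕ) → (Fin r → ℕ) → Set
Realizes A c α = row A ≗ c × col A ≗ α

Realizable : (Fin n → ℕ) → (Fin r → ℕ) → Set
Realizable c α = ∃[ A ] Realizes A c α

sumF-row≡sumF-col : (A : Matrix n r) → sumF (row A) ≡ sumF (col A)
sumF-row≡sumF-col A = sumF-comm (λ x t → χ (A x t))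

put-≗ : (A : Fin n → ℕ) (x : Fin n) {a : ℕ} → a ≡ A x → put A x a ≗ A
put-≗ A x a≡ y with y ≟ᶠ x
... | yes refl = trans (put-here A x) a≡
... | no y≢x   = put-else A y≢x

shift : (Fin r → Bool) → Fin r → Fin r → Fin r → Bool
shift v i j = put (put v j true) i false

-- Balance form of moving a 1 from `i` to `j`: unit vectors stand on both sides, so no subtraction
-- occurs. The column bookkeeping below is cancellation from this identity.
shift-δ : (v : Fin r → Bool) {i j : Fin r} → v i ≡ true → v j ≡ false →
          ∀ t → χ (shift v i j t) + δ i t ≡ χ (v t) + δ j t
shift-δ v {i} {j} vi vj t with t ≟ᶠ i
shift-δ v {i} {j} vi vj t | yes refl with t ≟ᶠ j
... | yes refl = contradiction (trans (sym vi) vj) λ ()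
... | no t≢j rewrite put-here (put v j true) t {false} | vi = refl
shift-δ v {i} {j} vi vj t | no t≢i rewrite put-else (put v j true) {a = false} t≢i with t ≟ᶠ j
... | yes refl rewrite put-here v t {true} | vj = refl
... | no t≢j rewrite put-else v {a = true} t≢j = refl

size-shift : (v : Fin r → Bool) {i j : Fin r} → v i ≡ true → v j ≡ false →
             size (shift v i j) ≡ size v
size-shift v {i} {j} vi vj = suc-injective (begin
  suc (size (shift v i j))                       ≡⟨ +-comm 1 _ ⟩
  size (shift v i j) + 1                         ≡⟨ cong (size (shift v i j) +_) (sumF-δ i) ⟨
  size (shift v i j) + sumF (δ i)                ≡⟨ sumF-+ (χ ∘ shift v i j) (δ i) ⟨
  sumF (λ t → χ (shift v i j t) + δ i t)         ≡⟨ sumF-cong (shift-δ v vi vj) ⟩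
  sumF (λ t → χ (v t) + δ j t)                   ≡⟨ sumF-+ (χ ∘ v) (δ j) ⟩
  size v + sumF (δ j)                            ≡⟨ cong (size v +_) (sumF-δ j) ⟩
  size v + 1                                     ≡⟨ +-comm _ 1 ⟩
  suc (size v)                                   ∎)
  where open ≡-Reasoning

move : Matrix n r → Fin n → Fin r → Fin r → Matrix n r
move A x i j = put A x (shift (A x) i j)

row-move : (A : Matrix n r) (x : Fin n) {i j : Fin r} → A x i ≡ true → A x j ≡ false →
           row (move A x i j) ≗ row A
row-move A x Axi Axj y =
  trans (map-put size A x y) (put-≗ (row A) x (size-shift (A x) Axi Axj) y)

-- Column `t` changes only in row `x`, where `shift-δ` gives the balance; the replaced entry
-- `χ (A x t)` is added on both sides and cancelled.
col-move : (A : Matrix n r) (x : Fin n) {i j : Fin r} → A x i ≡ true → A x j ≡ false →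
           ∀ t → col (move A x i j) t + δ i t ≡ col A t + δ j t
col-move A x {i} {j} Axi Axj t = +-cancelʳ-≡ (χ (A x t)) _ _ (begin
  col A′ t + δ i t + χ (A x t)                    ≡⟨ xy∙z≈xz∙y (col A′ t) _ _ ⟩
  col A′ t + χ (A x t) + δ i t                    ≡⟨ cong (λ s → s + χ (A x t) + δ i t)
                                                       (sumF-cong (map-put (λ v → χ (v t)) A x)) ⟩
  sumF (put (λ y → χ (A y t)) x (χ (v t))) + χ (A x t) + δ i t
    ≡⟨ cong (_+ δ i t) (sumF-put (λ y → χ (A y t)) x (χ (v t))) ⟩
  col A t + χ (v t) + δ i t                       ≡⟨ +-assoc (col A t) _ _ ⟩
  col A t + (χ (v t) + δ i t)                     ≡⟨ cong (col A t +_) (shift-δ (A x) Axi Axj t) ⟩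
  col A t + (χ (A x t) + δ j t)                   ≡⟨ x∙yz≈xz∙y (col A t) _ _ ⟩
  col A t + δ j t + χ (A x t)                     ∎)
  where
  open ≡-Reasoning
  A′ = move A x i j
  v  = shift (A x) i j

-- Column sums of 0/1 matrices with prescribed row sums

-- Truncated subtraction makes this the number of positions where `A` has a 1 and `B` a 0, the
-- measure by which the alternating walk terminates.
excess : Matrix n r → Matrix n r → ℕ
excess A B = sumF (λ x → sumF (λ t → χ (A x t) ∸ χ (B x t)))

-- The moved 1 leaves a position where `B` has a 0, which lowers the measure, and lands where `B`
-- has a 1, which adds nothing.
excess-move : (A B : Matrix n r) (x : Fin n) {i j : Fin r} → A x i ≡ true → A x j ≡ false →
              B x i ≡ false → B x j ≡ true → excess (move A x i j) B < excess A B
excess-move A B x {i} {j} Axi Axj Bxi Bxj =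
  sumF-mono-< (λ y → sumF-mono-≤ (le y)) x (sumF-mono-< (le x) i lt)
  where
  i≢j : i ≢ j
  i≢j refl = contradiction (trans (sym Axi) Axj) λ ()
  le : ∀ y t → χ (move A x i j y t) ∸ χ (B y t) ≤ χ (A y t) ∸ χ (B y t)
  le y t with y ≟ᶠ x
  ... | no y≢x rewrite put-else A {a = shift (A x) i j} y≢x = ≤-refl
  ... | yes refl rewrite put-here A y {shift (A y) i j} with t ≟ᶠ i
  ...   | yes refl rewrite put-here (put (A y) j true) t {false} =
    ≤-trans (≤-reflexive (0∸n≡0 (χ (B y t)))) z≤n
  ...   | no t≢i rewrite put-else (put (A y) j true) {a = false} t≢i with t ≟ᶠ j
  ...     | yes refl rewrite Bxj = ≤-trans (χ∸1≤0 (put (A y) t true t)) z≤n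
    where
    χ∸1≤0 : ∀ b → χ b ∸ 1 ≤ 0
    χ∸1≤0 true  = z≤n
    χ∸1≤0 false = z≤n
  ...     | no t≢j rewrite put-else (A y) {a = true} t≢j = ≤-refl
  lt : χ (move A x i j x i) ∸ χ (B x i) < χ (A x i) ∸ χ (B x i)
  lt rewrite put-here A x {shift (A x) i j} | put-here (put (A x) j true) i {false} | Axi | Bxi = s≤s z≤n

-- Alternating walk: shifting a 1 of A towards B in one row repairs column i at the cost of column
-- j; if column j was not deficient it is now in excess, and the walk goes on from j.
column-exchange : (A B : Matrix n r) → row A ≗ row B → (i : Fin r) → col B i < col A i →
  ∃[ j ] ∃[ A′ ] col A j < col B j × row A′ ≗ row A ×
                 (∀ t → col A′ t + δ i t ≡ col A t + δ j t)
column-exchange {n} {r} A B = go A (<-wellFounded (excess A B))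
  where
  go : (A : Matrix n r) → Acc _<_ (excess A B) → row A ≗ row B → (i : Fin r) → col B i < col A i →
    ∃[ j ] ∃[ A′ ] col A j < col B j × row A′ ≗ row A ×
                   (∀ t → col A′ t + δ i t ≡ col A t + δ j t)
  go A (acc smaller) A~B i lt
    -- Column `i` of `A` is larger, so some row has a 1 there only in `A`; equal row sums then give
    -- a column `j` where that row has a 1 only in `B`.
    with x , Bxi<Axi ← sumF-<⇒∃< (λ x → χ (A x i)) (λ x → χ (B x i)) lt
    with j , Axj<Bxj ← sumF-≤∧>⇒∃< (χ ∘ B x) (χ ∘ A x) i (≤-reflexive (A~B x)) Bxi<Axi
    with Bxi , Axi ← χ-<⇒ Bxi<Axi | Axj , Bxj ← χ-<⇒ Axj<Bxj
    with col A j <? col B j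
  ... | yes deficient = j , move A x i j , deficient , row-move A x Axi Axj , col-move A x Axi Axj
  ... | no ¬deficient = continue (go A′ (smaller (excess-move A B x Axi Axj Bxi Bxj))
                                     (λ y → trans (row-move A x Axi Axj y) (A~B y)) j over)
    where
    A′ = move A x i j
    i≢j : i ≢ j
    i≢j refl = contradiction (trans (sym Axi) Axj) λ ()
    col-i : suc (col A′ i) ≡ col A i
    col-i = begin
      suc (col A′ i)     ≡⟨ +-comm 1 _ ⟩
      col A′ i + 1       ≡⟨ cong (col A′ i +_) (δ-here i) ⟨
      col A′ i + δ i i   ≡⟨ col-move A x Axi Axj i ⟩
      col A i + δ j i    ≡⟨ cong (col A i +_) (δ-else i≢j) ⟩
      col A i + 0        ≡⟨ +-identityʳ _ ⟩
      col A i            ∎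
      where open ≡-Reasoning
    col-≢i : ∀ {t} → t ≢ i → col A t ≤ col A′ t
    col-≢i {t} t≢i = begin
      col A t              ≤⟨ m≤m+n _ _ ⟩
      col A t + δ j t      ≡⟨ col-move A x Axi Axj t ⟨
      col A′ t + δ i t     ≡⟨ cong (col A′ t +_) (δ-else t≢i) ⟩
      col A′ t + 0         ≡⟨ +-identityʳ _ ⟩
      col A′ t             ∎
      where open ≤-Reasoning
    over : col B j < col A′ j
    over = begin-strict
      col B j              ≤⟨ ≮⇒≥ ¬deficient ⟩
      col A j              <⟨ n<1+n _ ⟩
      suc (col A j)        ≡⟨ +-comm 1 _ ⟩
      col A j + 1          ≡⟨ cong (col A j +_) (δ-here j) ⟨
      col A j + δ j j      ≡⟨ col-move A x Axi Axj j ⟨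
      col A′ j + δ i j     ≡⟨ cong (col A′ j +_) (δ-else (i≢j ∘ sym)) ⟩
      col A′ j + 0         ≡⟨ +-identityʳ _ ⟩
      col A′ j             ∎
      where open ≤-Reasoning
    continue : (∃[ l ] ∃[ A″ ] col A′ l < col B l × row A″ ≗ row A′ ×
                   (∀ t → col A″ t + δ j t ≡ col A′ t + δ l t)) →
               (∃[ l ] ∃[ A″ ] col A l < col B l × row A″ ≗ row A ×
                   (∀ t → col A″ t + δ i t ≡ col A t + δ l t))
    continue (l , A″ , A′l<Bl , A″~A′ , col″) =
      l , A″ , ≤-<-trans (col-≢i l≢i) A′l<Bl ,
      (λ y → trans (A″~A′ y) (row-move A x Axi Axj y)) , eq
      where
      -- Column `i` has lost a single 1, so it still has at least `col B i` ones and cannot be the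
      -- deficient column in which the walk ends.
      l≢i : l ≢ i
      l≢i refl = <⇒≱ A′l<Bl (≤-pred (subst (col B i <_) (sym col-i) lt))
      eq : ∀ t → col A″ t + δ i t ≡ col A t + δ l t
      eq t = +-cancelʳ-≡ (δ j t) _ _ (begin
        col A″ t + δ i t + δ j t     ≡⟨ xy∙z≈xz∙y (col A″ t) _ _ ⟩
        col A″ t + δ j t + δ i t     ≡⟨ cong (_+ δ i t) (col″ t) ⟩
        col A′ t + δ l t + δ i t     ≡⟨ xy∙z≈xz∙y (col A′ t) _ _ ⟩
        col A′ t + δ i t + δ l t     ≡⟨ cong (_+ δ l t) (col-move A x Axi Axj t) ⟩
        col A t + δ j t + δ l t      ≡⟨ xy∙z≈xz∙y (col A t) _ _ ⟩
        col A t + δ l t + δ j t      ∎)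
        where
        open ≡-Reasoning

-- Matrices realizing α and β share their row sums `c`, so `column-exchange` applies; its balance
-- equation is `exchange α i j` written without subtraction.
realizable-MConvex : (c : Fin n → ℕ) → MConvexSet r (Realizable c)
realizable-MConvex c α β (A , A~c , A~α) (B , B~c , B~β) i βi<αi
  with j , A′ , Aj<Bj , A′~A , col′ ← column-exchange A B (λ x → trans (A~c x) (sym (B~c x))) i
         (subst₂ _<_ (sym (B~β i)) (sym (A~α i)) βi<αi)
  = j , αj<βj , A′ , (λ x → trans (A′~A x) (A~c x)) , A′~exchange
  where
  αj<βj : α j < β j
  αj<βj = subst₂ _<_ (A~α j) (B~β j) Aj<Bj
  A′~exchange : ∀ t → col A′ t ≡ exchange α i j t
  A′~exchange t with col′ t
  ... | eq rewrite A~α t with t ≟ᶠ i | t ≟ᶠ j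
  ... | yes refl | yes refl = contradiction αj<βj (<⇒≯ βi<αi)
  ... | yes refl | no  _    = trans (sym (m+n∸n≡m (col A′ t) 1))
                                (trans (cong (_∸ 1) (trans eq (+-identityʳ _))) (sym (+-identityʳ _)))
  ... | no  _    | yes refl = trans (sym (+-identityʳ _)) eq
  ... | no  _    | no  _    = trans (sym (+-identityʳ _)) eq

-- Gale–Ryser: the first column may be chosen to hit the largest row sums, ties being broken by lin.
FirstColumnGreedy : (Fin n → ℕ) → Matrix n (suc r) → Set
FirstColumnGreedy lin A =
  ∀ x y → A x fzero ≡ true → A y fzero ≡ false → lin x < lin y → row A y < row A x

-- Call a row marked if it has a 1 in the first column. In a violating pair `x` is marked and `y` is
-- not; row `y`, being no smaller, has a 1 in some column `t` where row `x` has a 0. Swapping these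
-- four entries keeps all row and column sums.
greedy : (lin : Fin n → ℕ) (A : Matrix n (suc r)) →
         ∃[ A′ ] row A′ ≗ row A × col A′ ≗ col A × FirstColumnGreedy lin A′
greedy {n} {r} lin A = go A (<-wellFounded (cost A))
  where
  -- The swap marks `y` and unmarks `x`, so the weight of `y` is traded for that of `x`, whose row
  -- sum is no larger and whose `lin` is strictly smaller.
  cost : Matrix n (suc r) → ℕ
  cost A = sumF (λ x → if A x fzero then 0 else row A x + lin x)
  go : (A : Matrix n (suc r)) → Acc _<_ (cost A) →
       ∃[ A′ ] row A′ ≗ row A × col A′ ≗ col A × FirstColumnGreedy lin A′
  go A (acc smaller)
    with any? (λ x → any? (λ y → (A x fzero Bool.≟ true) ×-dec (A y fzero Bool.≟ false)
                                 ×-dec (lin x <? lin y) ×-dec (row A x ≤? row A y)))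
  ... | no none = A , (λ _ → refl) , (λ _ → refl) ,
                  λ x y Ax Ay x<y → ≰⇒> (λ Ax≤Ay → none (x , y , Ax , Ay , x<y , Ax≤Ay))
  ... | yes (x , y , Ax , Ay , x<y , Ax≤Ay)
    with t , Axt<Ayt ← sumF-≤∧>⇒∃< (χ ∘ A y) (χ ∘ A x) fzero Ax≤Ay
                         (subst₂ (λ a b → χ a < χ b) (sym Ay) (sym Ax) (s≤s z≤n))
    with Axt , Ayt ← χ-<⇒ Axt<Ayt
    = continue (go A″ (smaller cheaper))
    where
    x≢y : x ≢ y
    x≢y refl = contradiction (trans (sym Ax) Ay) λ ()
    A′ = move A x fzero t
    A′y : A′ y ≡ A y
    A′y = put-else A (x≢y ∘ sym)
    A′yt : A′ y t ≡ true
    A′yt = trans (cong (λ v → v t) A′y) Ayt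
    A′y0 : A′ y fzero ≡ false
    A′y0 = trans (cong (λ v → v fzero) A′y) Ay
    A″ = move A′ y t fzero
    rows : row A″ ≗ row A
    rows z = trans (row-move A′ y A′yt A′y0 z) (row-move A x Ax Axt z)
    cols : col A″ ≗ col A
    cols s = +-cancelʳ-≡ (δ t s + δ fzero s) _ _ (begin
      col A″ s + (δ t s + δ fzero s)    ≡⟨ +-assoc (col A″ s) _ _ ⟨
      col A″ s + δ t s + δ fzero s      ≡⟨ cong (_+ δ fzero s) (col-move A′ y A′yt A′y0 s) ⟩
      col A′ s + δ fzero s + δ fzero s  ≡⟨ cong (_+ δ fzero s) (col-move A x Ax Axt s) ⟩
      col A s + δ t s + δ fzero s       ≡⟨ +-assoc (col A s) _ _ ⟩
      col A s + (δ t s + δ fzero s)     ∎)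
      where open ≡-Reasoning
    t≢0 : fzero ≢ t
    t≢0 refl = contradiction (trans (sym Ax) Axt) λ ()
    weight : Fin n → ℕ
    weight z = if A z fzero then 0 else row A z + lin z
    weight″ : ∀ z → (if A″ z fzero then 0 else row A″ z + lin z) ≡
                    put (put weight y 0) x (row A x + lin x) z
    weight″ z with z ≟ᶠ x
    ... | yes refl
      rewrite put-here (put weight y 0) z {row A z + lin z} | rows z
            | put-else A′ {a = shift (A′ y) t fzero} x≢y | put-here A z {shift (A z) fzero t} = refl
    ... | no z≢x rewrite put-else (put weight y 0) {a = row A x + lin x} z≢x with z ≟ᶠ y
    ...   | yes refl rewrite put-here weight z {0} | put-here A′ z {shift (A′ z) t fzero}
                           | put-else (put (A′ z) fzero true) {a = false} t≢0 = refl
    ...   | no z≢y rewrite put-else weight {a = 0} z≢y | rows z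
                         | put-else A′ {a = shift (A′ y) t fzero} z≢y
                         | put-else A {a = shift (A x) fzero t} z≢x = refl
    cheaper : cost A″ < cost A
    cheaper = +-cancelʳ-< (row A y + lin y) (cost A″) (cost A) (begin-strict
      cost A″ + (row A y + lin y)
        ≡⟨ cong₂ _+_ (sumF-cong weight″) (sym weights) ⟩
      sumF (put (put weight y 0) x (row A x + lin x)) + (weight x + weight y)
        ≡⟨ sumF-put₂ weight x≢y (row A x + lin x) 0 ⟩
      cost A + (row A x + lin x + 0)
        ≡⟨ cong (cost A +_) (+-identityʳ _) ⟩
      cost A + (row A x + lin x)
        <⟨ +-monoʳ-< (cost A) (+-mono-≤-< Ax≤Ay x<y) ⟩
      cost A + (row A y + lin y) ∎)
      where
      open ≤-Reasoning
      weights : weight x + weight y ≡ row A y + lin y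
      weights rewrite Ax | Ay = refl
    continue : (∃[ A‴ ] row A‴ ≗ row A″ × col A‴ ≗ col A″ × FirstColumnGreedy lin A‴) →
               (∃[ A‴ ] row A‴ ≗ row A × col A‴ ≗ col A × FirstColumnGreedy lin A‴)
    continue (A‴ , rows‴ , cols‴ , greedy‴) =
      A‴ , (λ z → trans (rows‴ z) (rows z)) , (λ s → trans (cols‴ s) (cols s)) , greedy‴

-- Rotations of the circle ℤ/(k+1)

[m+n%d]%d≡[m+n]%d : ∀ m n k → (m + n % suc k) % suc k ≡ (m + n) % suc k
[m+n%d]%d≡[m+n]%d m n k = begin
  (m + n % d) % d              ≡⟨ %-distribˡ-+ m (n % d) d ⟩
  (m % d + n % d % d) % d      ≡⟨ cong (λ a → (m % d + a) % d) (m%n%n≡m%n n d) ⟩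
  (m % d + n % d) % d          ≡⟨ %-distribˡ-+ m n d ⟨
  (m + n) % d                  ∎
  where
  open ≡-Reasoning
  d = suc k

toℕ-sucMod-< : ∀ {k} (i : Gen k) → toℕ i < k → toℕ (sucMod i) ≡ suc (toℕ i)
toℕ-sucMod-< {suc k} fzero    _         = refl
toℕ-sucMod-< {suc k} (fsuc i) (s≤s i<k) with sucMod i | toℕ-sucMod-< i i<k
... | fsuc j | eq = cong suc eq

sucMod-last : ∀ {k} (i : Gen k) → toℕ i ≡ k → sucMod i ≡ fzero
sucMod-last {zero}  fzero    _  = refl
sucMod-last {suc k} (fsuc i) eq with sucMod i | sucMod-last i (suc-injective eq)
... | fzero | refl = refl

toℕ-sucMod : ∀ {k} (i : Gen k) → toℕ (sucMod i) ≡ suc (toℕ i) % suc k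
toℕ-sucMod {k} i with m≤n⇒m<n∨m≡n (toℕ≤pred[n] i)
... | inj₁ i<k  = trans (toℕ-sucMod-< i i<k) (sym (m≤n⇒m%n≡m i<k))
... | inj₂ i≡k  = trans (cong toℕ (sucMod-last i i≡k))
                        (sym (trans (cong (λ a → suc a % suc k) i≡k) (n%n≡0 (suc k))))

rot : ∀ {k} → Gen k → ℕ → Gen k
rot s zero    = s
rot s (suc m) = sucMod (rot s m)

-- The number of forward steps from `s` to `x`; the full turn `suc k` keeps the subtraction from
-- truncating.
unrot : ∀ {k} → Gen k → Gen k → ℕ
unrot {k} s x = (suc k ∸ toℕ s + toℕ x) % suc k

toℕ-rot : ∀ {k} (s : Gen k) m → toℕ (rot s m) ≡ (m + toℕ s) % suc k
toℕ-rot s zero    = sym (m<n⇒m%n≡m (toℕ<n s))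
toℕ-rot {k} s (suc m) = begin
  toℕ (sucMod (rot s m))            ≡⟨ toℕ-sucMod (rot s m) ⟩
  suc (toℕ (rot s m)) % suc k       ≡⟨ cong (λ a → suc a % suc k) (toℕ-rot s m) ⟩
  (1 + (m + toℕ s) % suc k) % suc k ≡⟨ [m+n%d]%d≡[m+n]%d 1 (m + toℕ s) k ⟩
  (suc m + toℕ s) % suc k           ∎
  where open ≡-Reasoning

unrot-rot : ∀ {k} (s : Gen k) {m} → m ≤ k → unrot s (rot s m) ≡ m
unrot-rot {k} s {m} m≤k = begin
  (N ∸ toℕ s + toℕ (rot s m)) % N    ≡⟨ cong (λ a → (N ∸ toℕ s + a) % N) (toℕ-rot s m) ⟩
  (N ∸ toℕ s + (m + toℕ s) % N) % N  ≡⟨ [m+n%d]%d≡[m+n]%d (N ∸ toℕ s) _ k ⟩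
  (N ∸ toℕ s + (m + toℕ s)) % N      ≡⟨ cong (_% N) (x∙yz≈y∙xz (N ∸ toℕ s) m (toℕ s)) ⟩
  (m + (N ∸ toℕ s + toℕ s)) % N      ≡⟨ cong (λ a → (m + a) % N) (m∸n+n≡m (<⇒≤ (toℕ<n s))) ⟩
  (m + N) % N                        ≡⟨ [m+n]%n≡m%n m N ⟩
  m % N                              ≡⟨ m≤n⇒m%n≡m m≤k ⟩
  m                                  ∎
  where
  open ≡-Reasoning
  N = suc k

rot-unrot : ∀ {k} (s x : Gen k) → rot s (unrot s x) ≡ x
rot-unrot {k} s x = toℕ-injective (begin
  toℕ (rot s (unrot s x))                ≡⟨ toℕ-rot s (unrot s x) ⟩
  (unrot s x + toℕ s) % N                ≡⟨ cong (_% N) (+-comm (unrot s x) _) ⟩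
  (toℕ s + (N ∸ toℕ s + toℕ x) % N) % N  ≡⟨ [m+n%d]%d≡[m+n]%d (toℕ s) _ k ⟩
  (toℕ s + (N ∸ toℕ s + toℕ x)) % N      ≡⟨ cong (_% N) (x∙yz≈z∙yx (toℕ s) _ (toℕ x)) ⟩
  (toℕ x + (N ∸ toℕ s + toℕ s)) % N      ≡⟨ cong (λ a → (toℕ x + a) % N) (m∸n+n≡m (<⇒≤ (toℕ<n s))) ⟩
  (toℕ x + N) % N                        ≡⟨ [m+n]%n≡m%n (toℕ x) N ⟩
  toℕ x % N                              ≡⟨ m<n⇒m%n≡m (toℕ<n x) ⟩
  toℕ x                                  ∎)
  where
  open ≡-Reasoning
  N = suc k

unrot≤ : ∀ {k} (s x : Gen k) → unrot s x ≤ k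
unrot≤ {k} s x = ≤-pred (m%n<n (suc k ∸ toℕ s + toℕ x) (suc k))

rot-injective : ∀ {k} (s : Gen k) {m n} → m ≤ k → n ≤ k → rot s m ≡ rot s n → m ≡ n
rot-injective s m≤k n≤k eq =
  trans (sym (unrot-rot s m≤k)) (trans (cong (unrot s) eq) (unrot-rot s n≤k))

-- One step from `z` and then `k` more make a full turn, so the circle cut just after `z` has `z` as
-- its last point.
rot-sucMod-last : ∀ {k} (z : Gen k) → rot (sucMod z) k ≡ z
rot-sucMod-last {k} z = toℕ-injective (begin
  toℕ (rot (sucMod z) k)                 ≡⟨ toℕ-rot (sucMod z) k ⟩
  (k + toℕ (sucMod z)) % suc k           ≡⟨ cong (λ a → (k + a) % suc k) (toℕ-sucMod z) ⟩
  (k + suc (toℕ z) % suc k) % suc k      ≡⟨ [m+n%d]%d≡[m+n]%d k (suc (toℕ z)) k ⟩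
  (k + suc (toℕ z)) % suc k              ≡⟨ cong (_% suc k) (rearrange k (toℕ z)) ⟩
  (toℕ z + suc k) % suc k                ≡⟨ [m+n]%n≡m%n (toℕ z) (suc k) ⟩
  toℕ z % suc k                          ≡⟨ m<n⇒m%n≡m (toℕ<n z) ⟩
  toℕ z                                  ∎)
  where
  open ≡-Reasoning
  rearrange : ∀ a b → a + suc b ≡ b + suc a
  rearrange = solve-∀

sucMod-injective : ∀ {k} {i j : Gen k} → sucMod i ≡ sucMod j → i ≡ j
sucMod-injective {k} {i} {j} eq =
  trans (sym (rot-sucMod-last i)) (trans (cong (λ s → rot s k) eq) (rot-sucMod-last j))

sucMod≢ : ∀ {k} → 1 ≤ k → (i : Gen k) → sucMod i ≢ i
sucMod≢ 1≤k i eq = contradiction (rot-injective i 1≤k z≤n eq) λ ()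

sucMod²≢ : ∀ {k} → 2 ≤ k → (i : Gen k) → sucMod (sucMod i) ≢ i
sucMod²≢ 2≤k i eq = contradiction (rot-injective i 2≤k z≤n eq) λ ()

-- Isolates the small circles, where two steps lead back to `i` and there is no braid relation.
sucMod²≡⊎2≤ : ∀ {k} → (i : Gen k) → sucMod (sucMod i) ≡ i ⊎ 2 ≤ k
sucMod²≡⊎2≤ {zero}        fzero        = inj₁ refl
sucMod²≡⊎2≤ {suc zero}    fzero        = inj₁ refl
sucMod²≡⊎2≤ {suc zero}    (fsuc fzero) = inj₁ refl
sucMod²≡⊎2≤ {suc (suc k)} i            = inj₂ (s≤s (s≤s z≤n))

-- The action of the generators on codes

-- The new entries at `i` and `i + 1`. In the second branch `b < a`, so `pred` does not truncate.
hi lo : ℕ → ℕ → ℕ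
hi a b with a ≤? b
... | yes _ = suc b
... | no  _ = b
lo a b with a ≤? b
... | yes _ = a
... | no  _ = pred a

hi-up : ∀ {a b} → a ≤ b → hi a b ≡ suc b
hi-up {a} {b} a≤b with a ≤? b
... | yes _  = refl
... | no a≰b = contradiction a≤b a≰b

lo-up : ∀ {a b} → a ≤ b → lo a b ≡ a
lo-up {a} {b} a≤b with a ≤? b
... | yes _  = refl
... | no a≰b = contradiction a≤b a≰b

hi-down : ∀ {a b} → b < a → hi a b ≡ b
hi-down {a} {b} b<a with a ≤? b
... | yes a≤b = contradiction b<a (≤⇒≯ a≤b)
... | no _    = refl

lo-down : ∀ {a b} → b < a → lo a b ≡ pred a
lo-down {a} {b} b<a with a ≤? b
... | yes a≤b = contradiction b<a (≤⇒≯ a≤b)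
... | no _    = refl

-- The branches undo each other: `(b + 1 , a)` with `a ≤ b` is a descent, and `(b , a - 1)` with
-- `b < a` is not.
hi-involutive : ∀ a b → hi (hi a b) (lo a b) ≡ a
hi-involutive a b with ≤-<-connex a b
... | inj₁ a≤b rewrite hi-up a≤b | lo-up a≤b = hi-down (s≤s a≤b)
hi-involutive (suc a) b | inj₂ b<a@(s≤s b≤a)
  rewrite hi-down b<a | lo-down b<a = hi-up b≤a

lo-involutive : ∀ a b → lo (hi a b) (lo a b) ≡ b
lo-involutive a b with ≤-<-connex a b
... | inj₁ a≤b rewrite hi-up a≤b | lo-up a≤b = lo-down (s≤s a≤b)
lo-involutive (suc a) b | inj₂ b<a@(s≤s b≤a)
  rewrite hi-down b<a | lo-down b<a = lo-up b≤a

Triple : Set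
Triple = ℕ × ℕ × ℕ

act₁ act₂ : Triple → Triple
act₁ (a , b , c) = hi a b , lo a b , c
act₂ (a , b , c) = a , hi b c , lo b c

up₁ : ∀ {a b c} → a ≤ b → act₁ (a , b , c) ≡ (suc b , a , c)
up₁ a≤b rewrite hi-up a≤b | lo-up a≤b = refl

up₂ : ∀ {a b c} → b ≤ c → act₂ (a , b , c) ≡ (a , suc c , b)
up₂ b≤c rewrite hi-up b≤c | lo-up b≤c = refl

down₁ : ∀ {a b c} → b ≤ a → act₁ (suc a , b , c) ≡ (b , a , c)
down₁ b≤a rewrite hi-down (s≤s b≤a) | lo-down (s≤s b≤a) = refl

down₂ : ∀ {a b c} → c ≤ b → act₂ (a , suc b , c) ≡ (a , c , b)
down₂ c≤b rewrite hi-down (s≤s c≤b) | lo-down (s≤s c≤b) = refl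

chain : ∀ {X : Set} {f g h : X → X} (p : X) {q r s} → h p ≡ q → g q ≡ r → f r ≡ s → f (g (h p)) ≡ s
chain _ refl refl refl = refl

-- Six cases, like the six orders of three entries. When the two adjacent comparisons disagree, the
-- first entry (lowered by one if it descends) is compared with the third.
act-braid : ∀ t → act₁ (act₂ (act₁ t)) ≡ act₂ (act₁ (act₂ t))
act-braid t@(a , b , c) with ≤-<-connex a b | ≤-<-connex b c
... | inj₁ a≤b | inj₁ b≤c =
  trans (chain {f = act₁} {act₂} {act₁} t (up₁ a≤b) (up₂ (≤-trans a≤b b≤c)) (up₁ (s≤s b≤c)))
   (sym (chain {f = act₂} {act₁} {act₂} t (up₂ b≤c) (up₁ (≤-trans a≤b (m≤n⇒m≤1+n b≤c))) (up₂ a≤b)))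
... | inj₁ a≤b | inj₂ c<b@(s≤s c≤b) with ≤-<-connex a c
...   | inj₁ a≤c =
  trans (chain {f = act₁} {act₂} {act₁} t (up₁ a≤b) (up₂ a≤c) (down₁ c<b))
   (sym (chain {f = act₂} {act₁} {act₂} t (down₂ c≤b) (up₁ a≤c) (up₂ (≤-trans a≤c c≤b))))
...   | inj₂ (s≤s c≤a) =
  trans (chain {f = act₁} {act₂} {act₁} t (up₁ a≤b) (down₂ c≤a) (down₁ (<⇒≤ c<b)))
   (sym (chain {f = act₂} {act₁} {act₂} t (down₂ c≤b) (down₁ c≤a) (up₂ (≤-pred a≤b))))
act-braid t@(suc a , b , c) | inj₂ (s≤s b≤a) | inj₁ b≤c with ≤-<-connex a c
...   | inj₁ a≤c =
  trans (chain {f = act₁} {act₂} {act₁} t (down₁ b≤a) (up₂ a≤c) (up₁ (m≤n⇒m≤1+n b≤c)))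
   (sym (chain {f = act₂} {act₁} {act₂} t (up₂ b≤c) (up₁ (s≤s a≤c)) (down₂ b≤a)))
...   | inj₂ c<a@(s≤s c≤a) =
  trans (chain {f = act₁} {act₂} {act₁} t (down₁ b≤a) (down₂ c≤a) (up₁ b≤c))
   (sym (chain {f = act₂} {act₁} {act₂} t (up₂ b≤c) (down₁ c<a) (down₂ (≤-trans b≤c c≤a))))
act-braid t@(suc a , b , c) | inj₂ (s≤s b≤a@(s≤s b≤a′)) | inj₂ (s≤s c≤b) =
  trans (chain {f = act₁} {act₂} {act₁} t (down₁ b≤a) (down₂ (≤-trans c≤b b≤a′)) (down₁ c≤b))
   (sym (chain {f = act₂} {act₁} {act₂} t (down₂ c≤b) (down₁ (m≤n⇒m≤1+n (≤-trans c≤b b≤a′)))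
     (down₂ b≤a′)))

-- Codes of words, and congruence of words.

Code : ℕ → Set
Code k = Gen k → ℕ

opaque
  act : ∀ {k} → Gen k → Code k → Code k
  act i c = put (put c (sucMod i) (lo (c i) (c (sucMod i)))) i (hi (c i) (c (sucMod i)))

apply : ∀ {k} → Word k → Code k → Code k
apply []      c = c
apply (i ∷ u) c = act i (apply u c)

code : ∀ {k} → Word k → Code k
code u = apply u (const 0)

-- This singles out the orbit of 0: `code-HasZero` and `tight-word` give the two inclusions. A
-- nonzero constant code has no descent either, but lies outside the orbit.
HasZero : ∀ {k} → Code k → Set
HasZero c = ∃[ z ] c z ≡ 0

-- The form in which reducedness is used: a letter changes the code sum by one, so equality means
-- that every letter, read from the right, raises it.
Tight : ∀ {k} → Word k → Set
Tight u = length u ≡ sumF (code u)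

∷-cong-≈ : ∀ {k} (i : Gen k) {u v : Word k} → u ≈ v → (i ∷ u) ≈ (i ∷ v)
∷-cong-≈ i ≈-refl        = ≈-refl
∷-cong-≈ i (≈-sym p)     = ≈-sym (∷-cong-≈ i p)
∷-cong-≈ i (≈-trans p q) = ≈-trans (∷-cong-≈ i p) (∷-cong-≈ i q)
∷-cong-≈ i (≈-rel a b p) = ≈-rel (i ∷ a) b p

++-congˡ-≈ : ∀ {k} (a : Word k) {u v : Word k} → u ≈ v → (a ++ u) ≈ (a ++ v)
++-congˡ-≈ []      p = p
++-congˡ-≈ (i ∷ a) p = ∷-cong-≈ i (++-congˡ-≈ a p)

++-congʳ-≈ : ∀ {k} (b : Word k) {u v : Word k} → u ≈ v → (u ++ b) ≈ (v ++ b)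
++-congʳ-≈ b ≈-refl        = ≈-refl
++-congʳ-≈ b (≈-sym p)     = ≈-sym (++-congʳ-≈ b p)
++-congʳ-≈ b (≈-trans p q) = ≈-trans (++-congʳ-≈ b p) (++-congʳ-≈ b q)
++-congʳ-≈ b (≈-rel a {l} {r} b′ p) = subst₂ _≈_ (reassoc l) (reassoc r) (≈-rel a (b′ ++ b) p)
  where
  reassoc : ∀ w → a ++ w ++ b′ ++ b ≡ (a ++ w ++ b′) ++ b
  reassoc w = trans (cong (a ++_) (sym (++-assoc w b′ b))) (sym (++-assoc a (w ++ b′) b))

prodF-cong-≈ : ∀ {k n} {f g : Fin n → Word k} → (∀ t → f t ≈ g t) → prodF f ≈ prodF g
prodF-cong-≈ {n = zero}          f≈g = ≈-refl
prodF-cong-≈ {n = suc n} {f} {g} f≈g =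
  ≈-trans (++-congʳ-≈ (prodF (f ∘ fsuc)) (f≈g fzero)) (++-congˡ-≈ (g fzero) (prodF-cong-≈ (f≈g ∘ fsuc)))

-- Distinct letters with `i + 1` before `i`, as a condition on pairs, which suits induction on the
-- word.
Decreasing : ∀ {k} → Word k → Set
Decreasing = AllPairs (λ a b → b ≢ a × b ≢ sucMod a)

-- The action of the generators satisfies the Coxeter relations.

module _ {k : ℕ} (1≤k : 1 ≤ k) where

  opaque
    unfolding act

    act-here : (i : Gen k) (c : Code k) → act i c i ≡ hi (c i) (c (sucMod i))
    act-here i c = put-here _ i

    act-next : (i : Gen k) (c : Code k) → act i c (sucMod i) ≡ lo (c i) (c (sucMod i))
    act-next i c = trans (put-else _ (sucMod≢ 1≤k i)) (put-here c (sucMod i))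

    act-else : (i : Gen k) (c : Code k) {x : Gen k} → x ≢ i → x ≢ sucMod i → act i c x ≡ c x
    act-else i c x≢i x≢si = trans (put-else _ x≢i) (put-else c x≢si)

    sumF-act : (i : Gen k) (c : Code k) → sumF (act i c) + (c i + c (sucMod i)) ≡
               sumF c + (hi (c i) (c (sucMod i)) + lo (c i) (c (sucMod i)))
    sumF-act i c = sumF-put₂ c (sucMod≢ 1≤k i ∘ sym) _ _

  act-unique : (i : Gen k) (c : Code k) {d : Code k} →
               d i ≡ hi (c i) (c (sucMod i)) → d (sucMod i) ≡ lo (c i) (c (sucMod i)) →
               (∀ {x} → x ≢ i → x ≢ sucMod i → d x ≡ c x) → d ≗ act i c
  act-unique i c at-i at-j else x with x ≟ᶠ i
  ... | yes refl = trans at-i (sym (act-here i c))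
  ... | no x≢i with x ≟ᶠ sucMod i
  ...   | yes refl = trans at-j (sym (act-next i c))
  ...   | no x≢si  = trans (else x≢i x≢si) (sym (act-else i c x≢i x≢si))

  act-cong : (i : Gen k) {c d : Code k} → c ≗ d → act i c ≗ act i d
  act-cong i {c} {d} c≗d = act-unique i d
    (trans (act-here i c) (cong₂ hi (c≗d i) (c≗d (sucMod i))))
    (trans (act-next i c) (cong₂ lo (c≗d i) (c≗d (sucMod i))))
    (λ x≢i x≢si → trans (act-else i c x≢i x≢si) (c≗d _))

  act-involutive : (i : Gen k) (c : Code k) → act i (act i c) ≗ c
  act-involutive i c = sym ∘ act-unique i (act i c)
    (trans (sym (hi-involutive (c i) (c (sucMod i)))) (sym (cong₂ hi (act-here i c) (act-next i c))))
    (trans (sym (lo-involutive (c i) (c (sucMod i)))) (sym (cong₂ lo (act-here i c) (act-next i c))))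
    (λ x≢i x≢si → sym (act-else i c x≢i x≢si))

  act-transpose : (i : Gen k) {c d : Code k} → c ≗ act i d → act i c ≗ d
  act-transpose i {c} {d} eq x = trans (act-cong i eq x) (act-involutive i d x)

  -- For distinct `i` and `j` the hypotheses make the pairs `i , i + 1` and `j , j + 1` disjoint, so
  -- neither step touches the entries read by the other.
  act-commute : (i j : Gen k) → j ≢ sucMod i → i ≢ sucMod j → (c : Code k) →
                act i (act j c) ≗ act j (act i c)
  act-commute i j j≢si i≢sj c with i ≟ᶠ j
  ... | yes refl = λ _ → refl
  ... | no i≢j   = act-unique j (act i c)
    (trans (act-else i (act j c) j≢i j≢si)
      (trans (act-here j c) (sym (cong₂ hi at-j at-sj))))
    (trans (act-else i (act j c) sj≢i sj≢si)
      (trans (act-next j c) (sym (cong₂ lo at-j at-sj))))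
    (λ x≢j x≢sj → act-cong-off x≢j x≢sj)
    where
    j≢i : j ≢ i
    j≢i = i≢j ∘ sym
    sj≢i : sucMod j ≢ i
    sj≢i = i≢sj ∘ sym
    sj≢si : sucMod j ≢ sucMod i
    sj≢si = j≢i ∘ sucMod-injective
    at-j : act i c j ≡ c j
    at-j = act-else i c j≢i j≢si
    at-sj : act i c (sucMod j) ≡ c (sucMod j)
    at-sj = act-else i c sj≢i sj≢si
    at-i : act j c i ≡ c i
    at-i = act-else j c i≢j i≢sj
    at-si : act j c (sucMod i) ≡ c (sucMod i)
    at-si = act-else j c (j≢si ∘ sym) (sj≢si ∘ sym)
    act-cong-off : ∀ {x} → x ≢ j → x ≢ sucMod j → act i (act j c) x ≡ act i c x
    act-cong-off {x} x≢j x≢sj with x ≟ᶠ i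
    ... | yes refl = trans (act-here i _) (trans (cong₂ hi at-i at-si) (sym (act-here i c)))
    ... | no x≢i with x ≟ᶠ sucMod i
    ...   | yes refl = trans (act-next i _) (trans (cong₂ lo at-i at-si) (sym (act-next i c)))
    ...   | no x≢si  = trans (act-else i _ x≢i x≢si)
                         (trans (act-else j c x≢j x≢sj) (sym (act-else i c x≢i x≢si)))

  window : Gen k → Code k → Triple
  window i c = c i , c (sucMod i) , c (sucMod (sucMod i))

  window-act₁ : 2 ≤ k → (i : Gen k) (c : Code k) → window i (act i c) ≡ act₁ (window i c)
  window-act₁ 2≤k i c = cong₂ _,_ (act-here i c) (cong₂ _,_ (act-next i c)
    (act-else i c (sucMod²≢ 2≤k i) (sucMod≢ 1≤k (sucMod i))))

  window-act₂ : 2 ≤ k → (i : Gen k) (c : Code k) → window i (act (sucMod i) c) ≡ act₂ (window i c)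
  window-act₂ 2≤k i c = cong₂ _,_ (act-else (sucMod i) c (sucMod≢ 1≤k i ∘ sym) (sucMod²≢ 2≤k i ∘ sym))
    (cong₂ _,_ (act-here (sucMod i) c) (act-next (sucMod i) c))

  -- Only the entries at `i`, `i + 1`, `i + 2` change; these positions are distinct since `2 ≤ k`,
  -- and on them the identity is `act-braid`.
  act-braided : 2 ≤ k → (i : Gen k) (c : Code k) →
                act i (act (sucMod i) (act i c)) ≗ act (sucMod i) (act i (act (sucMod i) c))
  act-braided 2≤k i c = pointwise
    where
    j = sucMod i
    windows : window i (act i (act j (act i c))) ≡ window i (act j (act i (act j c)))
    windows = begin
      window i (act i (act j (act i c)))  ≡⟨ window-act₁ 2≤k i _ ⟩
      act₁ (window i (act j (act i c)))   ≡⟨ cong act₁ (window-act₂ 2≤k i _) ⟩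
      act₁ (act₂ (window i (act i c)))    ≡⟨ cong (act₁ ∘ act₂) (window-act₁ 2≤k i c) ⟩
      act₁ (act₂ (act₁ (window i c)))     ≡⟨ act-braid (window i c) ⟩
      act₂ (act₁ (act₂ (window i c)))     ≡⟨ cong (act₂ ∘ act₁) (window-act₂ 2≤k i c) ⟨
      act₂ (act₁ (window i (act j c)))    ≡⟨ cong act₂ (window-act₁ 2≤k i _) ⟨
      act₂ (window i (act i (act j c)))   ≡⟨ window-act₂ 2≤k i _ ⟨
      window i (act j (act i (act j c)))  ∎
      where open ≡-Reasoning
    pointwise : act i (act j (act i c)) ≗ act j (act i (act j c))
    pointwise x with x ≟ᶠ i | x ≟ᶠ j | x ≟ᶠ sucMod j
    ... | yes refl | _        | _        = cong proj₁ windows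
    ... | no _     | yes refl | _        = cong (proj₁ ∘ proj₂) windows
    ... | no _     | no _     | yes refl = cong (proj₂ ∘ proj₂) windows
    ... | no x≢i   | no x≢j   | no x≢l   = trans
      (trans (act-else i _ x≢i x≢j) (trans (act-else j _ x≢j x≢l) (act-else i c x≢i x≢j)))
      (sym (trans (act-else j _ x≢j x≢l) (trans (act-else i _ x≢i x≢j) (act-else j c x≢j x≢l))))

  -- Codes as invariants, and code sums against lengths.

  apply-++ : (u v : Word k) (c : Code k) → apply (u ++ v) c ≡ apply u (apply v c)
  apply-++ []      v c = refl
  apply-++ (i ∷ u) v c = cong (act i) (apply-++ u v c)

  apply-cong : (u : Word k) {c d : Code k} → c ≗ d → apply u c ≗ apply u d
  apply-cong []      c≗d = c≗d
  apply-cong (i ∷ u) c≗d = act-cong i (apply-cong u c≗d)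

  apply-rel : {l r : Word k} → BasicRel k l r → (c : Code k) → apply l c ≗ apply r c
  apply-rel (square i)              c = act-involutive i c
  apply-rel (braid 2≤k i)           c = act-braided 2≤k i c
  apply-rel (commute i j j≢si i≢sj) c = act-commute i j j≢si i≢sj c

  code-≈ : {u v : Word k} → u ≈ v → code u ≗ code v
  code-≈ ≈-refl        x = refl
  code-≈ (≈-sym p)     x = sym (code-≈ p x)
  code-≈ (≈-trans p q) x = trans (code-≈ p x) (code-≈ q x)
  code-≈ (≈-rel a {l} {r} b p) = subst₂ _≗_ (sym (split l)) (sym (split r))
    (apply-cong a (apply-rel p (code b)))
    where
    split : ∀ w → code (a ++ w ++ b) ≡ apply a (apply w (code b))
    split w = trans (apply-++ a (w ++ b) _) (cong (apply a) (apply-++ w b _))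

  sumF-act-up : (i : Gen k) (c : Code k) → c i ≤ c (sucMod i) → sumF (act i c) ≡ suc (sumF c)
  sumF-act-up i c up = +-cancelʳ-≡ (c i + c (sucMod i)) _ _ (begin
    sumF (act i c) + (c i + c (sucMod i))
      ≡⟨ sumF-act i c ⟩
    sumF c + (hi (c i) (c (sucMod i)) + lo (c i) (c (sucMod i)))
      ≡⟨ cong₂ (λ a b → sumF c + (a + b)) (hi-up up) (lo-up up) ⟩
    sumF c + (suc (c (sucMod i)) + c i)
      ≡⟨ rearrange (sumF c) (c (sucMod i)) (c i) ⟩
    suc (sumF c) + (c i + c (sucMod i)) ∎)
    where
    open ≡-Reasoning
    rearrange : ∀ s a b → s + (suc a + b) ≡ suc s + (b + a)
    rearrange = solve-∀

  act-here-down : (i : Gen k) (c : Code k) → c (sucMod i) < c i → act i c i ≡ c (sucMod i)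
  act-here-down i c down = trans (act-here i c) (hi-down down)

  act-next-down : (i : Gen k) (c : Code k) → c (sucMod i) < c i → act i c (sucMod i) ≡ pred (c i)
  act-next-down i c down = trans (act-next i c) (lo-down down)

  sumF-act-down : (i : Gen k) (c : Code k) → c (sucMod i) < c i → sumF c ≡ suc (sumF (act i c))
  sumF-act-down i c down = trans (sumF-cong (sym ∘ act-involutive i c))
    (sumF-act-up i (act i c) (subst₂ _≤_ (sym (act-here-down i c down)) (sym (act-next-down i c down))
      (<⇒≤pred down)))

  sumF-act-≤ : (i : Gen k) (c : Code k) → sumF (act i c) ≤ suc (sumF c)
  sumF-act-≤ i c with ≤-<-connex (c i) (c (sucMod i))
  ... | inj₁ up   = ≤-reflexive (sumF-act-up i c up)
  ... | inj₂ down = ≤-trans (≤-trans (n≤1+n _) (≤-reflexive (sym (sumF-act-down i c down)))) (n≤1+n _)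

  sumF-code≤length : (u : Word k) → sumF (code u) ≤ length u
  sumF-code≤length []      = ≤-reflexive (sumF-zero (suc k))
  sumF-code≤length (i ∷ u) = ≤-trans (sumF-act-≤ i (code u)) (s≤s (sumF-code≤length u))

  tight-tail : (i : Gen k) (u : Word k) → Tight (i ∷ u) → Tight u
  tight-tail i u tight = ≤-antisym
    (≤-pred (≤-trans (≤-reflexive tight) (sumF-act-≤ i (code u)))) (sumF-code≤length u)

  -- A letter acting at a descent would lower the code sum, leaving it two short of the length.
  tight-up : (i : Gen k) (u : Word k) → Tight (i ∷ u) → code u i ≤ code u (sucMod i)
  tight-up i u tight = ≮⇒≥ λ down → <⇒≢ (n≤1+n (suc (length u)))
    (trans (tight-tail i u tight) (trans (sumF-act-down i (code u) down) (cong suc (sym tight))))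

  act-up-descends : (i : Gen k) (c : Code k) → c i ≤ c (sucMod i) → act i c (sucMod i) < act i c i
  act-up-descends i c up = subst₂ _<_ (sym (trans (act-next i c) (lo-up up)))
    (sym (trans (act-here i c) (hi-up up))) (s≤s up)

  -- A zero at `i` moves up to `i + 1`; a zero at `i + 1` below a positive entry at `i` moves to
  -- `i`; any other zero stays.
  act-HasZero : (i : Gen k) {c : Code k} → HasZero c → HasZero (act i c)
  act-HasZero i {c} (z , cz≡0) with ≤-<-connex (c i) 0
  ... | inj₁ ci≤0 = sucMod i , trans (act-next i c) (trans (lo-up (≤-trans ci≤0 z≤n)) (n≤0⇒n≡0 ci≤0))
  ... | inj₂ 0<ci with z ≟ᶠ i | z ≟ᶠ sucMod i
  ...   | yes refl | _        = contradiction (sym cz≡0) (<⇒≢ 0<ci)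
  ...   | no _     | yes refl = i , trans (act-here-down i c (subst (_< c i) (sym cz≡0) 0<ci)) cz≡0
  ...   | no z≢i   | no z≢si  = z , trans (act-else i c z≢i z≢si) cz≡0

  code-HasZero : (u : Word k) → HasZero (code u)
  code-HasZero []      = fzero , refl
  code-HasZero (i ∷ u) = act-HasZero i (code-HasZero u)

  -- A code without descents is weakly increasing all around the circle, hence constant.
  descent : (c : Code k) → HasZero c → c ≗ const 0 ⊎ ∃[ i ] c (sucMod i) < c i
  descent c (z , cz≡0) with any? (λ i → c (sucMod i) <? c i)
  ... | yes found = inj₂ found
  ... | no none   = inj₁ λ x → n≤0⇒n≡0 (begin
    c x                      ≤⟨ increasing x (unrot x z) ⟩
    c (rot x (unrot x z))    ≡⟨ cong c (rot-unrot x z) ⟩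
    c z                      ≡⟨ cz≡0 ⟩
    0                        ∎)
    where
    open ≤-Reasoning
    increasing : ∀ x m → c x ≤ c (rot x m)
    increasing x zero    = ≤-refl
    increasing x (suc m) = ≤-trans (increasing x m) (≮⇒≥ λ down → none (_ , down))

  -- Induction on the sum: a nonzero code has a descent, and acting there lowers the sum by one and
  -- keeps a zero. The descents met on the way to 0 spell the word.
  tight-word : (c : Code k) → HasZero c → ∃[ u ] Tight u × code u ≗ c
  tight-word c zero-c = go (sumF c) c refl zero-c
    where
    go : ∀ m (c : Code k) → sumF c ≡ m → HasZero c → ∃[ u ] Tight u × code u ≗ c
    go m c sum zero-c with descent c zero-c
    go m c sum zero-c | inj₁ c≗0 = [] , sym (sumF-zero (suc k)) , sym ∘ c≗0
    go zero c sum zero-c | inj₂ (i , down) =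
      contradiction (trans (sym (sumF-act-down i c down)) sum) λ ()
    go (suc m) c sum zero-c | inj₂ (i , down)
      with u , tight , u≗ ← go m (act i c) (suc-injective (trans (sym (sumF-act-down i c down)) sum))
                               (act-HasZero i zero-c)
      = i ∷ u
      , trans (cong suc (trans tight (sumF-cong u≗)))
          (trans (sym (sumF-act-down i c down)) (sumF-cong (sym ∘ act-transpose i u≗)))
      , act-transpose i u≗

  -- Length and equality of elements are read off the code

  -- The induction statement of an analogue of Matsumoto's theorem.
  Joins : ℕ → Set
  Joins m = ∀ (u v : Word k) → length u ≡ m → Tight u → Tight v → code u ≗ code v → u ≈ v

  tight-length : (u v : Word k) → Tight u → Tight v → code u ≗ code v → length u ≡ length v
  tight-length u v tu tv eq = trans tu (trans (sumF-cong eq) (sym tv))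

  -- Local confluence: reduced words of c starting with two descents i and j of c both continue through
  -- a reduced word of act j (act i c), or of act i (act j (act i c)) if i and j are adjacent.
  module Peak {m : ℕ} (IH : Joins m) {i j : Gen k} {u v : Word k} (len : length u ≡ m)
              (tu : Tight (i ∷ u)) (tv : Tight (j ∷ v)) (eq : code (i ∷ u) ≗ code (j ∷ v)) where

    c : Code k
    c = code (i ∷ u)

    sum-c : sumF c ≡ suc m
    sum-c = trans (sym tu) (cong suc len)

    zero-c : HasZero c
    zero-c = code-HasZero (i ∷ u)

    down-i : c (sucMod i) < c i
    down-i = act-up-descends i (code u) (tight-up i u tu)

    down-j : c (sucMod j) < c j
    down-j = subst₂ _<_ (sym (eq (sucMod j))) (sym (eq j)) (act-up-descends j (code v) (tight-up j v tv))

    -- Both `w` and `p` are tight words of length `m` for `act l c`, so the induction hypothesis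
    -- joins them.
    joins-below : ∀ l {w p} → Tight (l ∷ w) → c ≗ code (l ∷ w) → length p ≡ m → code p ≗ act l c → w ≈ p
    joins-below l {w} {p} tlw c≗ len-p p≗ = IH w p len-w (tight-tail l w tlw)
      (trans len-p (trans (sym len-w) (trans (tight-tail l w tlw) (sumF-cong w≗p)))) w≗p
      where
      len-w : length w ≡ m
      len-w = suc-injective (trans tlw (trans (sumF-cong (sym ∘ c≗)) sum-c))
      w≗p : code w ≗ code p
      w≗p x = trans (sym (act-transpose l c≗ x)) (sym (p≗ x))

    same : i ≡ j → (i ∷ u) ≈ (j ∷ v)
    same refl = ∷-cong-≈ i (joins-below i tu (λ _ → refl) len-v v≗)
      where
      v≗ : code v ≗ act i c
      v≗ x = sym (act-transpose i eq x)
      len-v : length v ≡ m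
      len-v = trans (suc-injective (sym (tight-length (i ∷ u) (j ∷ v) tu tv eq))) len

    commuting : i ≢ j → j ≢ sucMod i → i ≢ sucMod j → (i ∷ u) ≈ (j ∷ v)
    commuting i≢j j≢si i≢sj
      with t , tight , t≗ ← tight-word (act j (act i c)) (act-HasZero j (act-HasZero i zero-c))
      = ≈-trans (∷-cong-≈ i (joins-below i tu (λ _ → refl) (len-t t tight t≗) (act-transpose j t≗)))
          (≈-trans (≈-rel [] t (commute i j j≢si i≢sj))
            (≈-sym (∷-cong-≈ j (joins-below j tv eq (len-t t tight t≗)
              (act-transpose i (λ x → trans (t≗ x) (act-commute j i i≢sj j≢si c x)))))))
      where
      down-j′ : act i c (sucMod j) < act i c j
      down-j′ = subst₂ _<_ (sym (act-else i c (i≢sj ∘ sym) (i≢j ∘ sym ∘ sucMod-injective)))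
        (sym (act-else i c (i≢j ∘ sym) j≢si)) down-j
      len-t : ∀ t → Tight t → code t ≗ act j (act i c) → suc (length t) ≡ m
      len-t t tight t≗ = suc-injective (begin
        2 + length t                      ≡⟨ cong (2 +_) (trans tight (sumF-cong t≗)) ⟩
        2 + sumF (act j (act i c))        ≡⟨ cong suc (sumF-act-down j (act i c) down-j′) ⟨
        1 + sumF (act i c)                ≡⟨ sumF-act-down i c down-i ⟨
        sumF c                            ≡⟨ sum-c ⟩
        suc m                             ∎)
        where open ≡-Reasoning

    braiding : 2 ≤ k → j ≡ sucMod i → (i ∷ u) ≈ (j ∷ v)
    braiding 2≤k refl
      with t , tight , t≗ ← tight-word (act i (act j (act i c)))
                              (act-HasZero i (act-HasZero j (act-HasZero i zero-c)))
      = ≈-trans (∷-cong-≈ i (joins-below i tu (λ _ → refl) (len-t t tight t≗)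
                  (act-transpose j (act-transpose i t≗))))
          (≈-trans (≈-rel [] t (braid 2≤k i))
            (≈-sym (∷-cong-≈ j (joins-below j tv eq (len-t t tight t≗)
              (act-transpose i (act-transpose j (λ x → trans (t≗ x) (act-braided 2≤k i c x))))))))
      where
      l = sucMod j
      at-l : act i c l ≡ c l
      at-l = act-else i c (sucMod²≢ 2≤k i) (sucMod≢ 1≤k j)
      -- The entries satisfy `c l < c j < c i`. The step at `i` leaves `c j` and `pred (c i)` before
      -- `c l`, so the steps at `j` and again at `i` are descents too.
      down-j′ : act i c l < act i c j
      down-j′ = subst₂ _<_ (sym at-l) (sym (act-next-down i c down-i)) (≤-trans down-j (<⇒≤pred down-i))
      down-i′ : act j (act i c) j < act j (act i c) i
      down-i′ = subst₂ _<_ (sym (trans (act-here-down j (act i c) down-j′) at-l))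
        (sym (trans (act-else j (act i c) (sucMod≢ 1≤k i ∘ sym) (sucMod²≢ 2≤k i ∘ sym))
          (act-here-down i c down-i)))
        down-j
      len-t : ∀ t → Tight t → code t ≗ act i (act j (act i c)) → 2 + length t ≡ m
      len-t t tight t≗ = suc-injective (begin
        3 + length t                          ≡⟨ cong (3 +_) (trans tight (sumF-cong t≗)) ⟩
        3 + sumF (act i (act j (act i c)))    ≡⟨ cong (2 +_) (sumF-act-down i (act j (act i c)) down-i′) ⟨
        2 + sumF (act j (act i c))            ≡⟨ cong suc (sumF-act-down j (act i c) down-j′) ⟨
        1 + sumF (act i c)                    ≡⟨ sumF-act-down i c down-i ⟨
        sumF c                                ≡⟨ sum-c ⟩
        suc m                                 ∎)
        where open ≡-Reasoning

    adjacent : j ≡ sucMod i → (i ∷ u) ≈ (j ∷ v)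
    adjacent refl with sucMod²≡⊎2≤ i
    -- On a circle of two points the descents at `i` and `j` would give `c i < c j < c i`.
    ... | inj₁ ssi≡i = contradiction down-i (<⇒≯ (subst (λ x → c x < c j) ssi≡i down-j))
    ... | inj₂ 2≤k   = braiding 2≤k refl

  tight-joins : ∀ m → Joins m
  tight-joins m       []      []      _   _  _  _  = ≈-refl
  tight-joins m       []      (j ∷ v) _   tu tv eq = contradiction (tight-length [] (j ∷ v) tu tv eq) λ ()
  tight-joins m       (i ∷ u) []      _   tu tv eq = contradiction (tight-length (i ∷ u) [] tu tv eq) λ ()
  tight-joins (suc m) (i ∷ u) (j ∷ v) len tu tv eq with i ≟ᶠ j | j ≟ᶠ sucMod i | i ≟ᶠ sucMod j
  ... | yes i≡j | _        | _        = Peak.same (tight-joins m) {u = u} {v} (suc-injective len) tu tv eq i≡j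
  ... | no _    | yes j≡si | _        =
    Peak.adjacent (tight-joins m) {u = u} {v} (suc-injective len) tu tv eq j≡si
  ... | no _    | no _     | yes i≡sj =
    ≈-sym (Peak.adjacent (tight-joins m) {u = v} {u} len-v tv tu (sym ∘ eq) i≡sj)
    where
    len-v : length v ≡ m
    len-v = suc-injective (trans (sym (tight-length (i ∷ u) (j ∷ v) tu tv eq)) len)
  ... | no i≢j  | no j≢si  | no i≢sj  =
    Peak.commuting (tight-joins m) {u = u} {v} (suc-injective len) tu tv eq i≢j j≢si i≢sj

  -- Induction on an arbitrary word, with `t` tight for its tail. Either `i ∷ t` is tight and is
  -- joined with `u`, or `i` is a descent of `code t`; then `i ∷ u` is tight and joined with `t`,
  -- and the square relation gives `u ≈ i ∷ i ∷ u ≈ i ∷ t`.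
  tight⇒≈ : (w : Word k) {u : Word k} → Tight u → code u ≗ code w → u ≈ w
  tight⇒≈ []      {[]}    _  _  = ≈-refl
  tight⇒≈ []      {i ∷ u} tu eq = contradiction (tight-length (i ∷ u) [] tu (sym (sumF-zero (suc k))) eq) λ ()
  tight⇒≈ (i ∷ w) {u}     tu eq
    with t , tight , t≗ ← tight-word (code w) (code-HasZero w)
    with ≤-<-connex (code t i) (code t (sucMod i))
  ... | inj₁ up = ≈-trans (tight-joins _ u (i ∷ t) refl tu
          (trans (cong suc tight) (sym (sumF-act-up i (code t) up)))
          (λ x → trans (eq x) (act-cong i (sym ∘ t≗) x)))
        (∷-cong-≈ i (tight⇒≈ w tight t≗))
  ... | inj₂ down = ≈-trans (≈-sym (≈-rel [] u (square i)))
        (∷-cong-≈ i (≈-trans (tight-joins _ (i ∷ u) t refl tight-iu tight iu≗t) (tight⇒≈ w tight t≗)))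
    where
    u≗ : code u ≗ act i (code t)
    u≗ x = trans (eq x) (act-cong i (sym ∘ t≗) x)
    iu≗t : code (i ∷ u) ≗ code t
    iu≗t = act-transpose i u≗
    tight-iu : Tight (i ∷ u)
    tight-iu = trans (cong suc (trans tu (sumF-cong u≗)))
      (trans (sym (sumF-act-down i (code t) down)) (sumF-cong (sym ∘ iu≗t)))

  reduced-form : (w : Word k) → ∃[ u ] Tight u × u ≈ w
  reduced-form w with u , tight , u≗ ← tight-word (code w) (code-HasZero w) = u , tight , tight⇒≈ w tight u≗

  -- Freeness of the orbit of 0: with `code-≈`, the code is a complete invariant of the group
  -- element.
  code≗⇒≈ : {u v : Word k} → code u ≗ code v → u ≈ v
  code≗⇒≈ {u} {v} eq with t , tight , t≈u ← reduced-form u =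
    ≈-trans (≈-sym t≈u) (tight⇒≈ v tight (λ x → trans (code-≈ t≈u x) (eq x)))

  sumF-code-minimal : {u w : Word k} → u ≈ w → sumF (code w) ≤ length u
  sumF-code-minimal {u} u≈w = ≤-trans (≤-reflexive (sumF-cong (sym ∘ code-≈ u≈w))) (sumF-code≤length u)

  isLength⇒≡ : {w : Word k} {m : ℕ} → IsLength w m → m ≡ sumF (code w)
  isLength⇒≡ {w} ((u , u≈w , refl) , minimal) with t , tight , t≈w ← reduced-form w =
    ≤-antisym (≤-trans (minimal t t≈w) (≤-reflexive (trans tight (sumF-cong (code-≈ t≈w)))))
              (sumF-code-minimal u≈w)

  isLength : {w : Word k} {m : ℕ} → m ≡ sumF (code w) → IsLength w m
  isLength {w} refl with u , tight , u≈w ← reduced-form w =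
    (u , u≈w , trans tight (sumF-cong (code-≈ u≈w))) , λ _ → sumF-code-minimal

  -- Replacing `u` by a tight word for the same element must not shorten `u ++ v` below its code
  -- sum, so `u` was already that short.
  tight-++ˡ : (u v : Word k) → Tight (u ++ v) → Tight u
  tight-++ˡ u v tight with t , tt , t≈u ← reduced-form u =
    ≤-antisym (+-cancelʳ-≤ (length v) (length u) (sumF (code u)) (begin
      length u + length v          ≡⟨ length-++ u ⟨
      length (u ++ v)              ≡⟨ tight ⟩
      sumF (code (u ++ v))         ≤⟨ sumF-code-minimal (++-congʳ-≈ v t≈u) ⟩
      length (t ++ v)              ≡⟨ length-++ t ⟩
      length t + length v          ≡⟨ cong (_+ length v) (trans tt (sumF-cong (code-≈ t≈u))) ⟩
      sumF (code u) + length v     ∎))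
      (sumF-code≤length u)
    where open ≤-Reasoning

  tight-++ʳ : (u v : Word k) → Tight (u ++ v) → Tight v
  tight-++ʳ []      v tight = tight
  tight-++ʳ (i ∷ u) v tight = tight-++ʳ u v (tight-tail i (u ++ v) tight)

  -- Cyclically decreasing words as columns of 0/1 matrices

  decreasing⇒unique : {u : Word k} → Decreasing u → Unique u
  decreasing⇒unique = AllPairs.map (λ p → proj₁ p ∘ sym)

  decreasing⇒precedes : {u : Word k} → Decreasing u → (i : Gen k) → i ∈ u → sucMod i ∈ u →
                        Precedes (sucMod i) i u
  decreasing⇒precedes (later ∷ dec) i (here refl) (here si≡i)  = contradiction si≡i (sucMod≢ 1≤k i)
  decreasing⇒precedes (later ∷ dec) i (here refl) (there si∈u) =
    contradiction refl (proj₂ (All.lookup later si∈u))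
  decreasing⇒precedes (later ∷ dec) i (there i∈u) (here refl)
    with a , b , refl ← ∈-∃++ i∈u = [] , a , b , refl
  decreasing⇒precedes (later ∷ dec) i (there i∈u) (there si∈u)
    with a , b , c , refl ← decreasing⇒precedes dec i i∈u si∈u = _ ∷ a , b , c , refl

  precedes⇒decreasing : (u : Word k) → Unique u →
    (∀ i → i ∈ u → sucMod i ∈ u → Precedes (sucMod i) i u) → Decreasing u
  precedes⇒decreasing []      []             prec = []
  precedes⇒decreasing (x ∷ u) (x∉u ∷ unique) prec =
    All.tabulate (λ y∈u → (λ y≡x → All.lookup x∉u y∈u (sym y≡x)) , λ { refl → not-next y∈u })
    ∷ precedes⇒decreasing u unique tail-prec
    where
    -- If `x + 1` came after the leading `x`, an `x` would have to follow some `x + 1`, and this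
    -- would be a second `x`.
    not-next : ¬ (sucMod x ∈ u)
    not-next sx∈u with prec x (here refl) (there sx∈u)
    ... | []    , b , c , eq = sucMod≢ 1≤k x (sym (proj₁ (∷-injective eq)))
    ... | _ ∷ a , b , c , eq with refl ← proj₂ (∷-injective eq) =
      All.lookup x∉u (∈-++⁺ʳ a (there (∈-++⁺ʳ b (here refl)))) refl
    tail-prec : ∀ i → i ∈ u → sucMod i ∈ u → Precedes (sucMod i) i u
    tail-prec i i∈u si∈u with prec i (there i∈u) (there si∈u)
    ... | []    , b , c , eq = contradiction (sym (proj₁ (∷-injective eq))) (All.lookup x∉u si∈u ∘ sym)
    ... | _ ∷ a , b , c , eq = a , b , c , proj₂ (∷-injective eq)

  decreasing⇒cyclicallyDecreasing : {u : Word k} → Tight u → Decreasing u → CyclicallyDecreasing u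
  decreasing⇒cyclicallyDecreasing {u} tight dec =
    u , ≈-refl , isLength tight , decreasing⇒unique dec , decreasing⇒precedes dec

  col-put₂ : ∀ {n} (A : Matrix (suc k) n) (i : Gen k) (a b : Fin n → Bool) (t : Fin n) →
             col (put (put A (sucMod i) b) i a) t + (χ (A i t) + χ (A (sucMod i) t)) ≡
             col A t + (χ (a t) + χ (b t))
  col-put₂ A i a b t = trans (cong (_+ (χ (A i t) + χ (A (sucMod i) t))) (sumF-cong pointwise))
    (sumF-put₂ (λ x → χ (A x t)) (sucMod≢ 1≤k i ∘ sym) (χ (a t)) (χ (b t)))
    where
    j = sucMod i
    pointwise : ∀ x → χ (put (put A j b) i a x t) ≡ put (put (λ y → χ (A y t)) j (χ (b t))) i (χ (a t)) x
    pointwise x with x ≟ᶠ i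
    ... | yes refl rewrite put-here (put A j b) i {a}
                         | put-here (put (λ y → χ (A y t)) j (χ (b t))) i {χ (a t)} = refl
    ... | no x≢i rewrite put-else (put A j b) {a = a} x≢i
                       | put-else (put (λ y → χ (A y t)) j (χ (b t))) {a = χ (a t)} x≢i
                       = map-put (λ v → χ (v t)) A j x

  act-up-unique : (i : Gen k) {c d : Code k} → c i ≤ c (sucMod i) →
                  d i ≡ suc (c (sucMod i)) → d (sucMod i) ≡ c i →
                  (∀ {x} → x ≢ i → x ≢ sucMod i → d x ≡ c x) → d ≗ act i c
  act-up-unique i {c} up at-i at-j else =
    act-unique i c (trans at-i (sym (hi-up up))) (trans at-j (sym (lo-up up))) else

  -- Generators acting on matrices by exchanging adjacent rows.

  module _ {n : ℕ} (A : Matrix (suc k) (suc n)) (i : Gen k) where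

    private
      j : Gen k
      j = sucMod i
      j≢i : j ≢ i
      j≢i = sucMod≢ 1≤k i

    -- Both exchange rows `i` and `i + 1`. `raise` marks the row arriving at `i` in the first
    -- column; `lower` erases the mark of the row arriving at `i + 1`.
    raise lower : Matrix (suc k) (suc n)
    raise = put (put A j (A i)) i (put (A j) fzero true)
    lower = put (put A j (put (A i) fzero false)) i (A j)

    raise-i : raise i ≡ put (A j) fzero true
    raise-i = put-here _ i

    raise-j : raise j ≡ A i
    raise-j = trans (put-else _ j≢i) (put-here A j)

    raise-else : ∀ {x} → x ≢ i → x ≢ j → raise x ≡ A x
    raise-else x≢i x≢j = trans (put-else _ x≢i) (put-else A x≢j)

    lower-i : lower i ≡ A j
    lower-i = put-here _ i

    lower-j : lower j ≡ put (A i) fzero false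
    lower-j = trans (put-else _ j≢i) (put-here A j)

    lower-else : ∀ {x} → x ≢ i → x ≢ j → lower x ≡ A x
    lower-else x≢i x≢j = trans (put-else _ x≢i) (put-else A x≢j)

    row-raise : A j fzero ≡ false → row A i ≤ row A j → row raise ≗ act i (row A)
    row-raise Aj up = act-up-unique i up
      (trans (cong size raise-i) (cong (λ b → suc (χ b + size (A j ∘ fsuc))) (sym Aj)))
      (cong size raise-j) (λ x≢i x≢j → cong size (raise-else x≢i x≢j))

    -- After erasing its mark the former row `i` is still at least as large as the former row `j`,
    -- so acting at `i` on the lowered matrix is an upward step back to `A`.
    row-lower : A i fzero ≡ true → row A j < row A i → row A ≗ act i (row lower)
    row-lower Ai Aj<Ai = act-up-unique i
      (subst₂ _≤_ (sym (cong size lower-i)) (sym (cong size lower-j))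
        (≤-pred (≤-trans Aj<Ai (≤-reflexive row-i))))
      (trans row-i (cong suc (sym (cong size lower-j)))) (sym (cong size lower-i))
      (λ x≢i x≢j → sym (cong size (lower-else x≢i x≢j)))
      where
      row-i : row A i ≡ suc (size (A i ∘ fsuc))
      row-i = cong (λ b → χ b + size (A i ∘ fsuc)) Ai

    col-raise-zero : A j fzero ≡ false → col raise fzero ≡ suc (col A fzero)
    col-raise-zero Aj = +-cancelʳ-≡ (χ (A i fzero) + 0) _ _ (trans
      (subst (λ b → col raise fzero + (χ (A i fzero) + χ b) ≡ col A fzero + (1 + χ (A i fzero))) Aj
        (col-put₂ A i (put (A j) fzero true) (A i) fzero))
      (rearrange (col A fzero) (χ (A i fzero))))
      where
      rearrange : ∀ a b → a + (1 + b) ≡ suc a + (b + 0)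
      rearrange = solve-∀

    col-lower-zero : A i fzero ≡ true → A j fzero ≡ false → col A fzero ≡ suc (col lower fzero)
    col-lower-zero Ai Aj = begin
      col A fzero                                                ≡⟨ +-identityʳ _ ⟨
      col A fzero + 0                                            ≡⟨ cong (λ b → col A fzero + χ b) Aj ⟨
      col A fzero + χ (A j fzero)                                ≡⟨ cong (col A fzero +_) (+-identityʳ _) ⟨
      col A fzero + (χ (A j fzero) + 0)
        ≡⟨ col-put₂ A i (A j) (put (A i) fzero false) fzero ⟨
      col lower fzero + (χ (A i fzero) + χ (A j fzero))
        ≡⟨ cong₂ (λ a b → col lower fzero + (χ a + χ b)) Ai Aj ⟩
      col lower fzero + 1                                        ≡⟨ +-comm _ 1 ⟩
      suc (col lower fzero)                                      ∎
      where open ≡-Reasoning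

    col-raise-suc : ∀ t → col raise (fsuc t) ≡ col A (fsuc t)
    col-raise-suc t = +-cancelʳ-≡ (χ (A i (fsuc t)) + χ (A j (fsuc t))) _ _
      (trans (col-put₂ A i (put (A j) fzero true) (A i) (fsuc t))
             (cong (col A (fsuc t) +_) (+-comm (χ (A j (fsuc t))) _)))

    col-lower-suc : ∀ t → col lower (fsuc t) ≡ col A (fsuc t)
    col-lower-suc t = +-cancelʳ-≡ (χ (A i (fsuc t)) + χ (A j (fsuc t))) _ _
      (trans (col-put₂ A i (A j) (put (A i) fzero false) (fsuc t))
             (cong (col A (fsuc t) +_) (+-comm (χ (A j (fsuc t))) _)))

  -- The rows marked in the new column are those sitting at the letters of u: since sᵢ₊₁ is applied
  -- after sᵢ, no row is raised twice.
  mark-column : ∀ {n} {α : Fin n → ℕ} (u v : Word k) → Tight (u ++ v) → Decreasing u →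
    Realizable (code v) α →
    ∃[ A ] row A ≗ code (u ++ v) × col A fzero ≡ length u × col A ∘ fsuc ≗ α ×
           (∀ x → A x fzero ≡ true → x ∈ u)
  mark-column []      v tight dec (B , rows , cols) =
    (λ x → false Vector.∷ B x) , rows , sumF-zero (suc k) , cols , λ _ ()
  mark-column (i ∷ u) v tight (later ∷ dec) real
    with A , rows , col₀ , cols , marked ← mark-column u v (tight-tail i (u ++ v) tight) dec real
    = raise A i
    , (λ x → trans (row-raise A i unmarked up x) (act-cong i rows x))
    , trans (col-raise-zero A i unmarked) (cong suc col₀)
    , (λ t → trans (col-raise-suc A i t) (cols t))
    , marks
    where
    j = sucMod i
    j∉u : ¬ (j ∈ u)
    j∉u j∈u = proj₂ (All.lookup later j∈u) refl
    unmarked : A j fzero ≡ false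
    unmarked = ¬-not (j∉u ∘ marked j)
    up : row A i ≤ row A j
    up = subst₂ _≤_ (sym (rows i)) (sym (rows j)) (tight-up i (u ++ v) tight)
    marks : ∀ x → raise A i x fzero ≡ true → x ∈ i ∷ u
    marks x mx with x ≟ᶠ i
    ... | yes refl = here refl
    ... | no x≢i with x ≟ᶠ j
    -- Row `j` is now the former row `i`; a mark on it would mean that `i` already occurs in `u`.
    ...   | yes refl = contradiction refl (proj₁ (All.lookup later
                         (marked i (trans (cong (λ r → r fzero) (sym (raise-j A i))) mx))))
    ...   | no x≢j   = there (marked x (trans (cong (λ r → r fzero) (sym (raise-else A i x≢i x≢j))) mx))

  realizable-prodF : ∀ n (f : Fin n → Word k) → Tight (prodF f) → (∀ t → Decreasing (f t)) →
                     Realizable (code (prodF f)) (length ∘ f)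
  realizable-prodF zero    f tight dec = (λ _ ()) , (λ _ → refl) , λ ()
  realizable-prodF (suc n) f tight dec
    with A , rows , col₀ , cols , _ ← mark-column (f fzero) (prodF (f ∘ fsuc)) tight (dec fzero)
           (realizable-prodF n (f ∘ fsuc) (tight-++ʳ (f fzero) _ tight) (dec ∘ fsuc))
    = A , rows , λ { fzero → col₀ ; (fsuc t) → cols t }

  -- The bound `p < m` on letters lets `rot s m` be prepended while keeping the word decreasing; the
  -- clause that unmarked rows stay unmarked keeps the positions already passed clear.
  Swept : ∀ {n} → Gen k → ℕ → Matrix (suc k) (suc n) → Set
  Swept s m A = ∃[ u ] ∃[ B ]
    Decreasing u × (∀ {x} → x ∈ u → ∃[ p ] p < m × x ≡ rot s p) ×
    row A ≗ apply u (row B) × col A fzero ≡ length u + col B fzero × col B ∘ fsuc ≗ col A ∘ fsuc ×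
    (∀ x → A x fzero ≡ false → B x fzero ≡ false) × (∀ p → p ≤ m → B (rot s p) fzero ≡ false)

  -- Read from the far end of the circle cut at s, the marked rows are moved one after the other past
  -- an unmarked row, which greediness keeps strictly smaller.
  sweep : ∀ {n} (s : Gen k) m → m ≤ k → (A : Matrix (suc k) (suc n)) → A (rot s m) fzero ≡ false →
    (∀ {p q} → p < q → q ≤ m → A (rot s p) fzero ≡ true → A (rot s q) fzero ≡ false →
       row A (rot s q) < row A (rot s p)) →
    Swept s m A
  sweep s zero    m≤k A carrier greedy =
    [] , A , [] , (λ ()) , (λ _ → refl) , refl , (λ _ → refl) , (λ _ Ax → Ax) , λ { zero z≤n → carrier }
  sweep s (suc m) m<k A carrier greedy with A (rot s m) fzero Bool.≟ true
  -- The unmarked row at `m` takes over as carrier; the old one at `m + 1` stays clear.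
  ... | no ¬marked
    with u , B , dec , letters , rows , col₀ , cols , mono , clear ←
           sweep s m (<⇒≤ m<k) A (¬-not ¬marked) (λ p<q q≤m → greedy p<q (m≤n⇒m≤1+n q≤m))
    = u , B , dec , (λ x∈u → let p , p<m , x≡ = letters x∈u in p , m<n⇒m<1+n p<m , x≡)
    , rows , col₀ , cols , mono , clear′
    where
    clear′ : ∀ p → p ≤ suc m → B (rot s p) fzero ≡ false
    clear′ p p≤1+m with m≤n⇒m<n∨m≡n p≤1+m
    ... | inj₁ (s≤s p≤m) = clear p p≤m
    ... | inj₂ refl      = mono _ carrier
  ... | yes marked = extend (sweep s m (<⇒≤ m<k) L L-carrier L-greedy)
    where
    i = rot s m
    j = sucMod i
    L = lower A i
    L-carrier : L i fzero ≡ false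
    L-carrier = trans (cong (λ r → r fzero) (lower-i A i)) carrier
    rot-≢ : ∀ {p q} → p < q → q ≤ k → rot s p ≢ rot s q
    rot-≢ p<q q≤k eq = <⇒≢ p<q (rot-injective s (≤-trans (<⇒≤ p<q) q≤k) q≤k eq)
    L-below : ∀ {p} → p < m → L (rot s p) ≡ A (rot s p)
    L-below p<m = lower-else A i (rot-≢ p<m (<⇒≤ m<k)) (rot-≢ (m<n⇒m<1+n p<m) m<k)
    L-greedy : ∀ {p q} → p < q → q ≤ m → L (rot s p) fzero ≡ true → L (rot s q) fzero ≡ false →
               row L (rot s q) < row L (rot s p)
    L-greedy {p} {q} p<q q≤m Lp Lq with m≤n⇒m<n∨m≡n q≤m
    ... | inj₁ q<m rewrite L-below (<-trans p<q q<m) | L-below q<m =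
      greedy p<q (m≤n⇒m≤1+n q≤m) Lp Lq
    -- The row now at `m` is the carrier from `m + 1`, so greediness is used at its old position.
    ... | inj₂ refl rewrite L-below p<q | lower-i A i = greedy (m<n⇒m<1+n p<q) ≤-refl Lp Lq
    distinct : ∀ {x} → ∃[ p ] p < m × x ≡ rot s p → x ≢ i × x ≢ j
    distinct (p , p<m , refl) = rot-≢ p<m (<⇒≤ m<k) , rot-≢ (m<n⇒m<1+n p<m) m<k
    L-mono : ∀ x → A x fzero ≡ false → L x fzero ≡ false
    L-mono x Ax with x ≟ᶠ i | x ≟ᶠ j
    ... | yes refl | _        = L-carrier
    ... | no _     | yes refl = cong (λ r → r fzero) (lower-j A i)
    ... | no x≢i   | no x≢j   = trans (cong (λ r → r fzero) (lower-else A i x≢i x≢j)) Ax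
    extend : Swept s m L → Swept s (suc m) A
    extend (u , B , dec , letters , rows , col₀ , cols , mono , clear) =
      i ∷ u , B , All.tabulate (λ x∈u → distinct (letters x∈u)) ∷ dec
      , (λ { (here refl) → m , ≤-refl , refl
           ; (there x∈u) → let p , p<m , x≡ = letters x∈u in p , m<n⇒m<1+n p<m , x≡ })
      , (λ x → trans (row-lower A i marked (greedy ≤-refl ≤-refl marked carrier) x) (act-cong i rows x))
      , trans (col-lower-zero A i marked carrier) (cong suc col₀)
      , (λ t → trans (cols t) (col-lower-suc A i t))
      , (λ x Ax → mono x (L-mono x Ax))
      , clear′
      where
      clear′ : ∀ p → p ≤ suc m → B (rot s p) fzero ≡ false
      clear′ p p≤1+m with m≤n⇒m<n∨m≡n p≤1+m
      ... | inj₁ (s≤s p≤m) = clear p p≤m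
      ... | inj₂ refl      = mono _ (cong (λ r → r fzero) (lower-j A i))

  -- Peeling off the first column and factoring.

  Peeled : ∀ {n} → Code k → (Fin (suc n) → ℕ) → Set
  Peeled c α = ∃[ u ] ∃[ d ] Decreasing u × length u ≡ α fzero × c ≗ apply u d × Realizable d (α ∘ fsuc)

  -- The circle is cut just after a zero entry `z`. Its row is empty, hence unmarked, and being last
  -- it serves as the first carrier; the tie-breaking order is the position along the cut circle. A
  -- full sweep clears the first column.
  peel-column : ∀ {n} {c : Code k} {α : Fin (suc n) → ℕ} → HasZero c → Realizable c α →
                Peeled c α
  peel-column {n} {c} {α} (z , cz≡0) (A₀ , rows₀ , cols₀)
    with A , rows , cols , greedy-A ← greedy (unrot (sucMod z)) A₀ =
    peel A rows cols (sweep s k ≤-refl A (Az A rows) (λ p<q q≤k Ap Aq → greedy-A _ _ Ap Aq (subst₂ _<_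
      (sym (unrot-rot s (≤-trans (<⇒≤ p<q) q≤k))) (sym (unrot-rot s q≤k)) p<q)))
    where
    s = sucMod z
    Az : ∀ (A : Matrix (suc k) (suc n)) → row A ≗ row A₀ → A (rot s k) fzero ≡ false
    Az A rows = unmarked (rot s k)
      (trans (cong (row A) (rot-sucMod-last z)) (trans (rows z) (trans (rows₀ z) cz≡0)))
      where
      unmarked : ∀ x → row A x ≡ 0 → A x fzero ≡ false
      unmarked x eq with A x fzero
      ... | false = refl
    peel : ∀ (A : Matrix (suc k) (suc n)) → row A ≗ row A₀ → col A ≗ col A₀ → Swept s k A → Peeled c α
    peel A rows cols (u , B , dec , _ , rowsB , col₀ , colsB , _ , clear) =
      u , row B , dec , length-u
      , (λ x → trans (sym (trans (rows x) (rows₀ x))) (rowsB x))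
      , (λ x → B x ∘ fsuc)
      , (λ x → cong (λ b → χ b + size (B x ∘ fsuc)) (sym (all-clear x)))
      , λ t → trans (colsB t) (trans (cols (fsuc t)) (cols₀ (fsuc t)))
      where
      all-clear : ∀ x → B x fzero ≡ false
      all-clear x = trans (cong (λ y → B y fzero) (sym (rot-unrot s x))) (clear (unrot s x) (unrot≤ s x))
      length-u : length u ≡ α fzero
      length-u = begin
        length u                  ≡⟨ +-identityʳ _ ⟨
        length u + 0              ≡⟨ cong (length u +_) (sumF-zero (suc k)) ⟨
        length u + sumF {suc k} (const 0)
                                  ≡⟨ cong (length u +_) (sumF-cong (λ x → cong χ (all-clear x))) ⟨
        length u + col B fzero    ≡⟨ col₀ ⟨
        col A fzero               ≡⟨ cols fzero ⟩
        col A₀ fzero              ≡⟨ cols₀ fzero ⟩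
        α fzero                   ∎
        where open ≡-Reasoning

  -- Involutions that preserve having a zero also reflect it; this supplies the zero at which to cut
  -- for the next column.
  apply-HasZero⁻ : (u : Word k) {d : Code k} → HasZero (apply u d) → HasZero d
  apply-HasZero⁻ []      zero-d = zero-d
  apply-HasZero⁻ (i ∷ u) {d} zero-d with z , eq ← act-HasZero i {act i (apply u d)} zero-d =
    apply-HasZero⁻ u {d} (z , trans (sym (act-involutive i (apply u d) z)) eq)

  Factored : ∀ {n} → Code k → (Fin n → ℕ) → Set
  Factored {n} c α = ∃[ f ] (∀ (t : Fin n) → Decreasing (f t)) × length ∘ f ≗ α × code (prodF f) ≗ c

  realizable⇒prodF : ∀ n (c : Code k) (α : Fin n → ℕ) → HasZero c → Realizable c α → Factored c α
  realizable⇒prodF zero    c α zero-c (A , rows , _) = (λ ()) , (λ ()) , (λ ()) , rows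
  realizable⇒prodF (suc n) c α zero-c real = factor (peel-column {n} {c} {α} zero-c real)
    where
    factor : Peeled c α → Factored c α
    factor (u , d , dec , len , c≗ , real′) = prepend (realizable⇒prodF n d (α ∘ fsuc) zero-d real′)
      where
      zero-d : HasZero d
      zero-d = apply-HasZero⁻ u {d} (proj₁ zero-c , trans (sym (c≗ (proj₁ zero-c))) (proj₂ zero-c))
      prepend : Factored d (α ∘ fsuc) → Factored c α
      prepend (f , decs , lens , code-f) =
        u Vector.∷ f , (λ { fzero → dec ; (fsuc t) → decs t }) , (λ { fzero → len ; (fsuc t) → lens t })
        , code-uf
        where
        code-uf : code (u ++ prodF f) ≗ c
        code-uf x = begin
          code (u ++ prodF f) x          ≡⟨ cong (λ e → e x) (apply-++ u (prodF f) (const 0)) ⟩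
          apply u (code (prodF f)) x     ≡⟨ apply-cong u {code (prodF f)} {d} code-f x ⟩
          apply u d x                    ≡⟨ c≗ x ⟨
          c x                            ∎
          where open ≡-Reasoning

  -- The support as the set of realizable column sums.

  length-prodF : ∀ {n} (f : Fin n → Word k) → length (prodF f) ≡ sumF (length ∘ f)
  length-prodF {zero}  f = refl
  length-prodF {suc n} f = trans (length-++ (f fzero)) (cong (length (f fzero) +_) (length-prodF (f ∘ fsuc)))

  tight-prodF : ∀ {n} (f : Fin n → Word k) → Tight (prodF f) → ∀ t → Tight (f t)
  tight-prodF f tight fzero    = tight-++ˡ (f fzero) _ tight
  tight-prodF f tight (fsuc t) = tight-prodF (f ∘ fsuc) (tight-++ʳ (f fzero) _ tight) t

  realizable-cong : ∀ {n r} {c d : Fin n → ℕ} {α β : Fin r → ℕ} → c ≗ d → α ≗ β →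
                    Realizable c α → Realizable d β
  realizable-cong c≗d α≗β (A , rows , cols) =
    A , (λ x → trans (rows x) (c≗d x)) , (λ t → trans (cols t) (α≗β t))

  -- The reduced decreasing words of the factors concatenate to a word for `w` of length `sumF α`,
  -- the length of `w`; hence it is tight and yields a matrix.
  inSupport⇒realizable : {w : Word k} {n : ℕ} {α : Fin n → ℕ} → InSupport w n α → Realizable (code w) α
  inSupport⇒realizable {w} {n} {α} (f , cycDec , lengths , f≈w , length-w) =
    realizable-cong (code-≈ u≈w) length-u (realizable-prodF n u tight decreasing)
    where
    u : Fin n → Word k
    u t = proj₁ (cycDec t)
    u≈f : ∀ t → u t ≈ f t
    u≈f t = proj₁ (proj₂ (cycDec t))
    u≈w : prodF u ≈ w
    u≈w = ≈-trans (prodF-cong-≈ u≈f) f≈w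
    length-u : ∀ t → length (u t) ≡ α t
    length-u t = trans (isLength⇒≡ (proj₁ (proj₂ (proj₂ (cycDec t)))))
      (trans (sumF-cong (code-≈ (u≈f t))) (sym (isLength⇒≡ (lengths t))))
    decreasing : ∀ t → Decreasing (u t)
    decreasing t = let _ , _ , _ , unique , prec = cycDec t in precedes⇒decreasing (u t) unique prec
    tight : Tight (prodF u)
    tight = begin
      length (prodF u)          ≡⟨ length-prodF u ⟩
      sumF (length ∘ u)         ≡⟨ sumF-cong length-u ⟩
      sumF α                    ≡⟨ isLength⇒≡ length-w ⟩
      sumF (code w)             ≡⟨ sumF-cong (code-≈ u≈w) ⟨
      sumF (code (prodF u))     ∎
      where open ≡-Reasoning

  -- Counting the ones of the matrix by rows and by columns gives `sumF α` as the code sum of `w`,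
  -- so the product word is tight, and with it each factor.
  realizable⇒inSupport : {w : Word k} {n : ℕ} {α : Fin n → ℕ} → Realizable (code w) α → InSupport w n α
  realizable⇒inSupport {w} {n} {α} real@(A , rows , cols) =
    support (realizable⇒prodF n (code w) α (code-HasZero w) real)
    where
    support : Factored (code w) α → InSupport w n α
    support (f , decs , lens , code-f) =
      f
      , (λ t → decreasing⇒cyclicallyDecreasing (tight-prodF f tight t) (decs t))
      , (λ t → isLength (trans (sym (lens t)) (tight-prodF f tight t)))
      , code≗⇒≈ code-f
      , isLength sum-α
      where
      sum-α : sumF α ≡ sumF (code w)
      sum-α = trans (sumF-cong (sym ∘ cols)) (trans (sym (sumF-row≡sumF-col A)) (sumF-cong rows))
      tight : Tight (prodF f)
      tight = trans (length-prodF f) (trans (sumF-cong lens) (trans sum-α (sumF-cong (sym ∘ code-f))))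

theorem4p6 : (k : ℕ) → 1 ≤ k → (w : Word k) → (n : ℕ) →
    StanleyPolyMConvex w n
theorem4p6 k 1≤k w n α β Jα Jβ i βi<αi =
  map₂ (map₂ (realizable⇒inSupport 1≤k))
    (realizable-MConvex (code w) α β (inSupport⇒realizable 1≤k Jα) (inSupport⇒realizable 1≤k Jβ) i βi<αi)
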